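{- Let $m$ and $d$ be positive integers with $m\ge3$. There exist a positive integer $N=N(m,d)$ and a block $B=(b_1,\ldots,b_N)\in\{0,1,\ldots,m-1\}^N$ such that for any real polynomial $P$ of degree $d$ and any sequence $(\eta_n)_n$ of real numbers with $|\eta_n|\le 1/20$ for all $n$, there exists $n\in[1,N]$ such that \[\lfloor P(n)+\eta_n\rfloor\not\equiv b_n\pmod m.\] -}

module Defs where

open import Algebra.Bundles.Raw using (RawSemiring)
import Algebra.Definitions.RawSemiring as RawSemiringDefs
import Data.Fin as Fin
open import Data.Integer as ℤ using (ℤ; +_; 1ℤ)
import Data.Integer.Divisibility as ℤ
import Data.Integer.Properties as ℤ
open import Data.Nat as ℕ using (ℕ; zero; suc)
import Data.Nat.Properties as ℕ
open import Data.Product using (∃-syntax; _×_; _,_)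
open import Data.Rational as ℚ using (ℚ; 0ℚ; 1ℚ; ½; mkℚ; *≤*)
open import Data.Rational.Literals using (fromℤ)
import Data.Rational.Properties as ℚ
open import Data.Rational.Solver using (module +-*-Solver)
open import Data.Sum using (inj₁; inj₂)
open import Data.Vec.Functional using (Vector)
open import Level using (0ℓ)
open import Relation.Binary.PropositionalEquality
open import Relation.Nullary using (¬_; yes; no; contradiction)

private
  variable
    d : ℕ

-- The library has no real numbers: they are represented here by Cauchy
-- sequences of rationals, with the equality _≈_ below in place of a quotient.

IsCauchy : (ℕ → ℚ) → Set
IsCauchy x = ∀ ε → 0ℚ ℚ.< ε →
  ∃[ N ] ∀ i j → N ℕ.≤ i → N ℕ.≤ j → ℚ.∣ x i ℚ.- x j ∣ ℚ.< ε

record ℝ : Set where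
  constructor mkℝ
  field
    seq    : ℕ → ℚ
    cauchy : IsCauchy seq

open ℝ public

infix 4 _≈_ _≤_ _<_

_≈_ : ℝ → ℝ → Set
x ≈ y = ∀ ε → 0ℚ ℚ.< ε →
  ∃[ N ] ∀ i → N ℕ.≤ i → ℚ.∣ seq x i ℚ.- seq y i ∣ ℚ.< ε

_≤_ : ℝ → ℝ → Set
x ≤ y = ∀ ε → 0ℚ ℚ.< ε →
  ∃[ N ] ∀ i → N ℕ.≤ i → seq x i ℚ.≤ seq y i ℚ.+ ε

_<_ : ℝ → ℝ → Set
x < y = ∃[ ε ] 0ℚ ℚ.< ε ×
  ∃[ N ] ∀ i → N ℕ.≤ i → seq x i ℚ.+ ε ℚ.≤ seq y i

private
  open +-*-Solver using (solve; _:=_; _:+_; _:*_; _:-_; :-_)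

  ½*-pos : ∀ {ε} → 0ℚ ℚ.< ε → 0ℚ ℚ.< ½ ℚ.* ε
  ½*-pos 0<ε = ℚ.*-monoʳ-<-pos ½ 0<ε

  ½+½ : ∀ ε → ½ ℚ.* ε ℚ.+ ½ ℚ.* ε ≡ ε
  ½+½ ε = trans (sym (ℚ.*-distribʳ-+ ε ½ ½)) (ℚ.*-identityˡ ε)

  p≤∣p∣ : ∀ p → p ℚ.≤ ℚ.∣ p ∣
  p≤∣p∣ p with ℚ.≤-total 0ℚ p
  ... | inj₁ 0≤p = ℚ.≤-reflexive (sym (ℚ.0≤p⇒∣p∣≡p 0≤p))
  ... | inj₂ p≤0 = ℚ.≤-trans p≤0 (ℚ.0≤∣p∣ p)

  ∣p-q∣≡∣q-p∣ : ∀ p q → ℚ.∣ p ℚ.- q ∣ ≡ ℚ.∣ q ℚ.- p ∣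
  ∣p-q∣≡∣q-p∣ p q = trans
    (cong ℚ.∣_∣ (solve 2 (λ p q → p :- q := :- (q :- p)) refl p q))
    (ℚ.∣-p∣≡∣p∣ (q ℚ.- p))

  p≡q+[p-q] : ∀ p q → p ≡ q ℚ.+ (p ℚ.- q)
  p≡q+[p-q] = solve 2 (λ p q → p := q :+ (p :- q)) refl

  p≤q+∣p-q∣ : ∀ p q → p ℚ.≤ q ℚ.+ ℚ.∣ p ℚ.- q ∣
  p≤q+∣p-q∣ p q = ℚ.≤-trans (ℚ.≤-reflexive (p≡q+[p-q] p q))
    (ℚ.+-monoʳ-≤ q (p≤∣p∣ (p ℚ.- q)))

  p<q+ε : ∀ {p q ε} → ℚ.∣ p ℚ.- q ∣ ℚ.< ε → p ℚ.< q ℚ.+ ε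
  p<q+ε {p} {q} h = ℚ.≤-<-trans (p≤q+∣p-q∣ p q) (ℚ.+-monoʳ-< q h)

  q<p+ε : ∀ {p q ε} → ℚ.∣ p ℚ.- q ∣ ℚ.< ε → q ℚ.< p ℚ.+ ε
  q<p+ε {p} {q} h = p<q+ε (subst (ℚ._< _) (∣p-q∣≡∣q-p∣ p q) h)

  ∣p∣-∣q∣≤∣p-q∣ : ∀ p q → ℚ.∣ p ∣ ℚ.- ℚ.∣ q ∣ ℚ.≤ ℚ.∣ p ℚ.- q ∣
  ∣p∣-∣q∣≤∣p-q∣ p q = begin
    ℚ.∣ p ∣ ℚ.- ℚ.∣ q ∣
      ≡⟨ cong (λ r → ℚ.∣ r ∣ ℚ.- ℚ.∣ q ∣) (p≡q+[p-q] p q) ⟩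
    ℚ.∣ q ℚ.+ (p ℚ.- q) ∣ ℚ.- ℚ.∣ q ∣
      ≤⟨ ℚ.+-monoˡ-≤ (ℚ.- ℚ.∣ q ∣) (ℚ.∣p+q∣≤∣p∣+∣q∣ q (p ℚ.- q)) ⟩
    (ℚ.∣ q ∣ ℚ.+ ℚ.∣ p ℚ.- q ∣) ℚ.- ℚ.∣ q ∣
      ≡⟨ solve 2 (λ a b → (a :+ b) :- a := b) refl ℚ.∣ q ∣ ℚ.∣ p ℚ.- q ∣ ⟩
    ℚ.∣ p ℚ.- q ∣ ∎
    where open ℚ.≤-Reasoning

  ∣∣p∣-∣q∣∣≤∣p-q∣ : ∀ p q → ℚ.∣ ℚ.∣ p ∣ ℚ.- ℚ.∣ q ∣ ∣ ℚ.≤ ℚ.∣ p ℚ.- q ∣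
  ∣∣p∣-∣q∣∣≤∣p-q∣ p q with ℚ.∣p∣≡p∨∣p∣≡-p (ℚ.∣ p ∣ ℚ.- ℚ.∣ q ∣)
  ... | inj₁ eq = subst (ℚ._≤ ℚ.∣ p ℚ.- q ∣) (sym eq) (∣p∣-∣q∣≤∣p-q∣ p q)
  ... | inj₂ eq = subst₂ ℚ._≤_
    (sym (trans eq (solve 2 (λ a b → :- (a :- b) := b :- a) refl ℚ.∣ p ∣ ℚ.∣ q ∣)))
    (∣p-q∣≡∣q-p∣ q p) (∣p∣-∣q∣≤∣p-q∣ q p)

  +-isCauchy : ∀ x y → IsCauchy (λ i → seq x i ℚ.+ seq y i)
  +-isCauchy x y ε 0<ε
    with M , hx ← cauchy x (½ ℚ.* ε) (½*-pos 0<ε)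
       | N , hy ← cauchy y (½ ℚ.* ε) (½*-pos 0<ε)
    = M ℕ.⊔ N , λ i j i≥ j≥ → begin-strict
      ℚ.∣ (seq x i ℚ.+ seq y i) ℚ.- (seq x j ℚ.+ seq y j) ∣
        ≡⟨ cong ℚ.∣_∣ (solve 4 (λ a b c e → (a :+ b) :- (c :+ e) := (a :- c) :+ (b :- e))
             refl (seq x i) (seq y i) (seq x j) (seq y j)) ⟩
      ℚ.∣ (seq x i ℚ.- seq x j) ℚ.+ (seq y i ℚ.- seq y j) ∣
        ≤⟨ ℚ.∣p+q∣≤∣p∣+∣q∣ (seq x i ℚ.- seq x j) (seq y i ℚ.- seq y j) ⟩
      ℚ.∣ seq x i ℚ.- seq x j ∣ ℚ.+ ℚ.∣ seq y i ℚ.- seq y j ∣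
        <⟨ ℚ.+-mono-< (hx i j (ℕ.m⊔n≤o⇒m≤o M N i≥) (ℕ.m⊔n≤o⇒m≤o M N j≥))
                      (hy i j (ℕ.m⊔n≤o⇒n≤o M N i≥) (ℕ.m⊔n≤o⇒n≤o M N j≥)) ⟩
      ½ ℚ.* ε ℚ.+ ½ ℚ.* ε ≡⟨ ½+½ ε ⟩
      ε ∎
    where open ℚ.≤-Reasoning

  bounded : ∀ x → ∃[ b ] 0ℚ ℚ.< b × ∃[ N ] ∀ i → N ℕ.≤ i → ℚ.∣ seq x i ∣ ℚ.≤ b
  bounded x with N , h ← cauchy x 1ℚ (ℚ.positive⁻¹ 1ℚ)
    = ℚ.∣ seq x N ∣ ℚ.+ 1ℚ
    , ℚ.+-mono-≤-< (ℚ.0≤∣p∣ (seq x N)) (ℚ.positive⁻¹ 1ℚ)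
    , N , λ i i≥ → ℚ.<⇒≤ (p<q+ε (ℚ.≤-<-trans (∣∣p∣-∣q∣∣≤∣p-q∣ (seq x i) (seq x N))
                                             (h i N i≥ ℕ.≤-refl)))

  divide : ∀ b ε → 0ℚ ℚ.< b → 0ℚ ℚ.< ε → ∃[ δ ] 0ℚ ℚ.< δ × b ℚ.* δ ≡ ε
  divide b ε 0<b 0<ε = δ
    , subst (ℚ._< δ) (ℚ.*-zeroʳ (ℚ.1/ b)) (ℚ.*-monoʳ-<-pos (ℚ.1/ b) 0<ε)
    , trans (sym (ℚ.*-assoc b (ℚ.1/ b) ε))
        (trans (cong (ℚ._* ε) (ℚ.*-inverseʳ b)) (ℚ.*-identityˡ ε))
    where
    instance
      b-pos : ℚ.Positive b
      b-pos = ℚ.positive 0<b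
      b-nonZero : ℚ.NonZero b
      b-nonZero = ℚ.pos⇒nonZero b
      1/b-pos : ℚ.Positive (ℚ.1/ b)
      1/b-pos = ℚ.1/pos⇒pos b
    δ : ℚ
    δ = ℚ.1/ b ℚ.* ε

  *-mono-bound : ∀ {b δ} p q → 0ℚ ℚ.< b → ℚ.∣ p ∣ ℚ.≤ b → ℚ.∣ q ∣ ℚ.< δ →
                 ℚ.∣ p ℚ.* q ∣ ℚ.< b ℚ.* δ
  *-mono-bound {b} {δ} p q 0<b ∣p∣≤b ∣q∣<δ = begin-strict
    ℚ.∣ p ℚ.* q ∣         ≡⟨ ℚ.∣p*q∣≡∣p∣*∣q∣ p q ⟩
    ℚ.∣ p ∣ ℚ.* ℚ.∣ q ∣   ≤⟨ ℚ.*-monoʳ-≤-nonNeg ℚ.∣ q ∣ {{ℚ.nonNegative (ℚ.0≤∣p∣ q)}} ∣p∣≤b ⟩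
    b ℚ.* ℚ.∣ q ∣         <⟨ ℚ.*-monoʳ-<-pos b {{ℚ.positive 0<b}} ∣q∣<δ ⟩
    b ℚ.* δ               ∎
    where open ℚ.≤-Reasoning

  split : ∀ p q r s → p ℚ.* q ℚ.- r ℚ.* s ≡ p ℚ.* (q ℚ.- s) ℚ.+ s ℚ.* (p ℚ.- r)
  split = solve 4 (λ p q r s → p :* q :- r :* s := p :* (q :- s) :+ s :* (p :- r)) refl

  *-close : ∀ {a b δ γ ε} p q r s → 0ℚ ℚ.< a → 0ℚ ℚ.< b →
            a ℚ.* δ ≡ ½ ℚ.* ε → b ℚ.* γ ≡ ½ ℚ.* ε →
            ℚ.∣ p ∣ ℚ.≤ a → ℚ.∣ s ∣ ℚ.≤ b →
            ℚ.∣ q ℚ.- s ∣ ℚ.< δ → ℚ.∣ p ℚ.- r ∣ ℚ.< γ →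
            ℚ.∣ p ℚ.* q ℚ.- r ℚ.* s ∣ ℚ.< ε
  *-close {a} {b} {δ} {γ} {ε} p q r s 0<a 0<b aδ≡ bγ≡ p≤ s≤ q-s< p-r< = begin-strict
    ℚ.∣ p ℚ.* q ℚ.- r ℚ.* s ∣
      ≡⟨ cong ℚ.∣_∣ (split p q r s) ⟩
    ℚ.∣ p ℚ.* (q ℚ.- s) ℚ.+ s ℚ.* (p ℚ.- r) ∣
      ≤⟨ ℚ.∣p+q∣≤∣p∣+∣q∣ (p ℚ.* (q ℚ.- s)) (s ℚ.* (p ℚ.- r)) ⟩
    ℚ.∣ p ℚ.* (q ℚ.- s) ∣ ℚ.+ ℚ.∣ s ℚ.* (p ℚ.- r) ∣
      <⟨ ℚ.+-mono-< (*-mono-bound p (q ℚ.- s) 0<a p≤ q-s<)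
                    (*-mono-bound s (p ℚ.- r) 0<b s≤ p-r<) ⟩
    a ℚ.* δ ℚ.+ b ℚ.* γ        ≡⟨ cong₂ ℚ._+_ aδ≡ bγ≡ ⟩
    ½ ℚ.* ε ℚ.+ ½ ℚ.* ε        ≡⟨ ½+½ ε ⟩
    ε                          ∎
    where open ℚ.≤-Reasoning

  *-isCauchy : ∀ x y → IsCauchy (λ i → seq x i ℚ.* seq y i)
  *-isCauchy x y ε 0<ε =
    let a , 0<a , K , x-bound = bounded x
        b , 0<b , L , y-bound = bounded y
        δ , 0<δ , aδ≡ = divide a (½ ℚ.* ε) 0<a (½*-pos 0<ε)
        γ , 0<γ , bγ≡ = divide b (½ ℚ.* ε) 0<b (½*-pos 0<ε)
        M , hy = cauchy y δ 0<δ
        N , hx = cauchy x γ 0<γ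
    in (K ℕ.⊔ L) ℕ.⊔ (M ℕ.⊔ N) , λ i j i≥ j≥ →
      let i≥KL = ℕ.m⊔n≤o⇒m≤o (K ℕ.⊔ L) (M ℕ.⊔ N) i≥
          i≥MN = ℕ.m⊔n≤o⇒n≤o (K ℕ.⊔ L) (M ℕ.⊔ N) i≥
          j≥KL = ℕ.m⊔n≤o⇒m≤o (K ℕ.⊔ L) (M ℕ.⊔ N) j≥
          j≥MN = ℕ.m⊔n≤o⇒n≤o (K ℕ.⊔ L) (M ℕ.⊔ N) j≥
      in *-close {a} {b} {δ} {γ} (seq x i) (seq y i) (seq x j) (seq y j) 0<a 0<b aδ≡ bγ≡
           (x-bound i (ℕ.m⊔n≤o⇒m≤o K L i≥KL)) (y-bound j (ℕ.m⊔n≤o⇒n≤o K L j≥KL))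
           (hy i j (ℕ.m⊔n≤o⇒m≤o M N i≥MN) (ℕ.m⊔n≤o⇒m≤o M N j≥MN))
           (hx i j (ℕ.m⊔n≤o⇒n≤o M N i≥MN) (ℕ.m⊔n≤o⇒n≤o M N j≥MN))

infixl 6 _+_
infixl 7 _*_

fromℚ : ℚ → ℝ
fromℚ q = mkℝ (λ _ → q) λ ε 0<ε →
  0 , λ _ _ _ _ → subst (ℚ._< ε) (sym (cong ℚ.∣_∣ (ℚ.+-inverseʳ q))) 0<ε

_+_ : ℝ → ℝ → ℝ
x + y = mkℝ (λ i → seq x i ℚ.+ seq y i) (+-isCauchy x y)

_*_ : ℝ → ℝ → ℝ
x * y = mkℝ (λ i → seq x i ℚ.* seq y i) (*-isCauchy x y)

∣_∣ : ℝ → ℝ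
∣ x ∣ = mkℝ (λ i → ℚ.∣ seq x i ∣) λ ε 0<ε → let N , h = cauchy x ε 0<ε in
  N , λ i j i≥ j≥ → ℚ.≤-<-trans (∣∣p∣-∣q∣∣≤∣p-q∣ (seq x i) (seq x j)) (h i j i≥ j≥)

ℤ→ℝ : ℤ → ℝ
ℤ→ℝ k = fromℚ (fromℤ k)

ℕ→ℝ : ℕ → ℝ
ℕ→ℝ n = ℤ→ℝ (+ n)

+-*-rawSemiring : RawSemiring 0ℓ 0ℓ
+-*-rawSemiring = record
  { Carrier = ℝ
  ; _≈_     = _≈_
  ; _+_     = _+_
  ; _*_     = _*_
  ; 0#      = ℕ→ℝ 0
  ; 1#      = ℕ→ℝ 1
  }

open RawSemiringDefs +-*-rawSemiring public using (sum; _^_)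

record Polynomial (d : ℕ) : Set where
  field
    coeff     : Vector ℝ (suc d)
    leading≉0 : ¬ (coeff (Fin.fromℕ d) ≈ ℕ→ℝ 0)

open Polynomial public

eval : Polynomial d → ℝ → ℝ
eval P x = sum (λ i → coeff P i * x ^ Fin.toℕ i)

-- The floor is a relation because no function ℝ → ℤ computing it can be
-- defined constructively; `floor-unique` and `¬¬floor-exists` below show that
-- the relation is single-valued and (classically) total.

IsFloor : ℝ → ℤ → Set
IsFloor x k = ℤ→ℝ k ≤ x × x < ℤ→ℝ (k ℤ.+ 1ℤ)

infix 4 _≡_[mod_]

_≡_[mod_] : ℤ → ℤ → ℕ → Set
a ≡ b [mod m ] = + m ℤ.∣ a ℤ.- b

private
  fromℤ-cancel-< : ∀ {k l} → fromℤ k ℚ.< fromℤ l → k ℤ.< l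
  fromℤ-cancel-< {k} {l} h =
    subst₂ ℤ._<_ (ℤ.*-identityʳ k) (ℤ.*-identityʳ l) (ℚ.drop-*<* h)

  fromℤ-+1 : ∀ k → fromℤ k ℚ.+ 1ℚ ≡ fromℤ (k ℤ.+ 1ℤ)
  fromℤ-+1 k = trans
    (cong (λ i → (i ℤ.+ 1ℤ) ℚ./ 1) (ℤ.*-identityʳ k))
    (ℚ.↥p/↧p≡p (fromℤ (k ℤ.+ 1ℤ)))

  p≤↥p : ∀ p → 0ℚ ℚ.≤ p → p ℚ.≤ fromℤ (+ ℤ.∣ ℚ.↥ p ∣)
  p≤↥p (mkℚ (+ n) e _) _ = *≤* (ℤ.*-monoˡ-≤-nonNeg (+ n) (ℤ.+≤+ (ℕ.s≤s ℕ.z≤n)))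
  p≤↥p (mkℚ ℤ.-[1+ n ] e _) (*≤* ())

  neg-fromℤ : ∀ c → ℚ.- fromℤ (+ c) ≡ fromℤ (ℤ.- + c)
  neg-fromℤ zero    = refl
  neg-fromℤ (suc c) = refl

  neg-bound : ∀ {p} c → ℚ.∣ p ∣ ℚ.≤ fromℤ (+ c) → fromℤ (ℤ.- + c) ℚ.≤ p
  neg-bound {p} c ∣p∣≤c = subst₂ ℚ._≤_ (neg-fromℤ c) (solve 1 (λ r → :- (:- r) := r) refl p)
    (ℚ.neg-antimono-≤ (ℚ.≤-trans (p≤∣p∣ (ℚ.- p))
      (subst (ℚ._≤ fromℤ (+ c)) (sym (ℚ.∣-p∣≡∣p∣ p)) ∣p∣≤c)))

  shift : ∀ c → ℤ.- + c ℤ.+ + suc (c ℕ.+ c) ≡ + c ℤ.+ 1ℤ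
  shift c = begin
    ℤ.- + c ℤ.+ + suc (c ℕ.+ c)      ≡⟨ cong (λ n → ℤ.- + c ℤ.+ + n) (ℕ.+-comm 1 (c ℕ.+ c)) ⟩
    ℤ.- + c ℤ.+ + (c ℕ.+ c ℕ.+ 1)    ≡⟨ cong (λ n → ℤ.- + c ℤ.+ + n) (ℕ.+-assoc c c 1) ⟩
    ℤ.- + c ℤ.+ (+ c ℤ.+ + (c ℕ.+ 1)) ≡⟨ sym (ℤ.+-assoc (ℤ.- + c) (+ c) (+ (c ℕ.+ 1))) ⟩
    (ℤ.- + c ℤ.+ + c) ℤ.+ + (c ℕ.+ 1) ≡⟨ cong (ℤ._+ + (c ℕ.+ 1)) (ℤ.+-inverseˡ (+ c)) ⟩
    ℤ.0ℤ ℤ.+ + (c ℕ.+ 1)              ≡⟨ ℤ.+-identityˡ (+ (c ℕ.+ 1)) ⟩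
    + c ℤ.+ 1ℤ                        ∎
    where open ≡-Reasoning

  ≤⇒≯ : ∀ {x y} → x ≤ y → ¬ (y < x)
  ≤⇒≯ {x} {y} x≤y (ε , 0<ε , N , y<x)
    with M , h ← x≤y (½ ℚ.* ε) (½*-pos 0<ε) = ℚ.<-irrefl refl (begin-strict
      seq x (M ℕ.⊔ N)                ≤⟨ h _ (ℕ.m≤m⊔n M N) ⟩
      seq y (M ℕ.⊔ N) ℚ.+ ½ ℚ.* ε    <⟨ ℚ.+-monoʳ-< (seq y (M ℕ.⊔ N)) ½ε<ε ⟩
      seq y (M ℕ.⊔ N) ℚ.+ ε          ≤⟨ y<x _ (ℕ.m≤n⊔m M N) ⟩
      seq x (M ℕ.⊔ N)                ∎)
    where
    open ℚ.≤-Reasoning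
    ½ε<ε : ½ ℚ.* ε ℚ.< ε
    ½ε<ε = subst₂ ℚ._<_ (ℚ.+-identityʳ (½ ℚ.* ε)) (½+½ ε)
      (ℚ.+-monoʳ-< (½ ℚ.* ε) (½*-pos 0<ε))

  ≮⇒≥ : ∀ x q → ¬ (x < fromℚ q) → fromℚ q ≤ x
  ≮⇒≥ x q x≮q ε 0<ε with N , h ← cauchy x (½ ℚ.* (½ ℚ.* ε)) (½*-pos (½*-pos 0<ε))
    with seq x N ℚ.+ ½ ℚ.* ε ℚ.≤? q
  ... | yes xN+½ε≤q = contradiction
    (δ , ½*-pos (½*-pos 0<ε) , N , λ i i≥ → begin
      seq x i ℚ.+ δ            ≤⟨ ℚ.+-monoˡ-≤ δ (ℚ.<⇒≤ (p<q+ε {seq x i} {seq x N} (h i N i≥ ℕ.≤-refl))) ⟩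
      (seq x N ℚ.+ δ) ℚ.+ δ    ≡⟨ ℚ.+-assoc (seq x N) δ δ ⟩
      seq x N ℚ.+ (δ ℚ.+ δ)    ≡⟨ cong (seq x N ℚ.+_) (½+½ (½ ℚ.* ε)) ⟩
      seq x N ℚ.+ ½ ℚ.* ε      ≤⟨ xN+½ε≤q ⟩
      q                        ∎)
    x≮q
    where
    open ℚ.≤-Reasoning
    δ = ½ ℚ.* (½ ℚ.* ε)
  ... | no xN+½ε≰q = N , λ i i≥ → begin
      q                                    ≤⟨ ℚ.<⇒≤ (ℚ.≰⇒> xN+½ε≰q) ⟩
      seq x N ℚ.+ ½ ℚ.* ε                  ≤⟨ ℚ.+-monoˡ-≤ (½ ℚ.* ε) (ℚ.<⇒≤ (q<p+ε {seq x i} {seq x N} (h i N i≥ ℕ.≤-refl))) ⟩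
      (seq x i ℚ.+ δ) ℚ.+ ½ ℚ.* ε          ≤⟨ ℚ.+-monoˡ-≤ (½ ℚ.* ε) (ℚ.+-monoʳ-≤ (seq x i) δ≤½ε) ⟩
      (seq x i ℚ.+ ½ ℚ.* ε) ℚ.+ ½ ℚ.* ε    ≡⟨ ℚ.+-assoc (seq x i) (½ ℚ.* ε) (½ ℚ.* ε) ⟩
      seq x i ℚ.+ (½ ℚ.* ε ℚ.+ ½ ℚ.* ε)    ≡⟨ cong (seq x i ℚ.+_) (½+½ ε) ⟩
      seq x i ℚ.+ ε                        ∎
    where
    open ℚ.≤-Reasoning
    δ = ½ ℚ.* (½ ℚ.* ε)
    δ≤½ε : δ ℚ.≤ ½ ℚ.* ε
    δ≤½ε = subst₂ ℚ._≤_ (ℚ.+-identityʳ δ) (½+½ (½ ℚ.* ε))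
      (ℚ.+-monoʳ-≤ δ (ℚ.<⇒≤ (½*-pos (½*-pos 0<ε))))

  sandwich : ∀ {x} k l → ℤ→ℝ k ≤ x → x < ℤ→ℝ l → k ℤ.< l
  sandwich {x} k l k≤x (ε , 0<ε , N , x<l) with fromℤ k ℚ.<? fromℤ l
  ... | yes k<l = fromℤ-cancel-< k<l
  ... | no k≮l = contradiction
    (ε , 0<ε , N , λ i i≥ → ℚ.≤-trans (x<l i i≥) (ℚ.≮⇒≥ k≮l)) (≤⇒≯ {ℤ→ℝ k} {x} k≤x)

  search : ∀ {x} j k → ℤ→ℝ k ≤ x → x < ℤ→ℝ (k ℤ.+ + j) → ¬ ¬ (∃[ l ] IsFloor x l)
  search {x} zero k k≤x x<k _ =
    ℤ.<-irrefl (sym (ℤ.+-identityʳ k)) (sandwich {x} k (k ℤ.+ + 0) k≤x x<k)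
  search {x} (suc j) k k≤x x<k+1+j ¬floor =
    search {x} j (k ℤ.+ 1ℤ)
      (≮⇒≥ x (fromℤ (k ℤ.+ 1ℤ)) λ x<k+1 → ¬floor (k , k≤x , x<k+1))
      (subst (λ l → x < ℤ→ℝ l) (sym (ℤ.+-assoc k 1ℤ (+ j))) x<k+1+j)
      ¬floor


floor-unique : ∀ {x k l} → IsFloor x k → IsFloor x l → k ≡ l
floor-unique {x} {k} {l} (k≤x , x<k+1) (l≤x , x<l+1) = ℤ.≤-antisym
  (below k l (sandwich {x} k (l ℤ.+ 1ℤ) k≤x x<l+1))
  (below l k (sandwich {x} l (k ℤ.+ 1ℤ) l≤x x<k+1))
  where
  below : ∀ i j → i ℤ.< j ℤ.+ 1ℤ → i ℤ.≤ j
  below i j i<j+1 = subst (i ℤ.≤_)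
    (trans (cong ℤ.pred (ℤ.+-comm j 1ℤ)) (ℤ.pred-suc j)) (ℤ.i<j⇒i≤pred[j] i<j+1)

¬¬floor-exists : ∀ x → ¬ ¬ (∃[ k ] IsFloor x k)
¬¬floor-exists x =
  let b , 0<b , N , x-bound = bounded x
      c = ℤ.∣ ℚ.↥ b ∣
      b≤c = p≤↥p b (ℚ.<⇒≤ 0<b)
  in search {x} (suc (c ℕ.+ c)) (ℤ.- + c)
    (λ ε 0<ε → N , λ i i≥ → ℚ.≤-trans
      (neg-bound c (ℚ.≤-trans (x-bound i i≥) b≤c))
      (subst (ℚ._≤ seq x i ℚ.+ ε) (ℚ.+-identityʳ (seq x i)) (ℚ.+-monoʳ-≤ (seq x i) (ℚ.<⇒≤ 0<ε))))
    (1ℚ , ℚ.positive⁻¹ 1ℚ , N , λ i i≥ → subst (seq x i ℚ.+ 1ℚ ℚ.≤_)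
      (trans (fromℤ-+1 (+ c)) (cong fromℤ (sym (shift c))))
      (ℚ.+-monoˡ-≤ 1ℚ (ℚ.≤-trans (p≤∣p∣ (seq x i)) (ℚ.≤-trans (x-bound i i≥) b≤c))))

{-# OPTIONS --safe #-}
-- A polynomial with real coefficients matters only up to multiples of m and up
-- to small errors, so on [1, N] it is represented by one of polynomially many
-- (in N) vectors of integers, its coefficients on a fine grid modulo m. At each
-- n a vector is compatible with at most two of the three residues 0, 1, 2,
-- because the enlarged windows [b - 1/10, b + 11/10] modulo m ≥ 3 have no common
-- point. Choosing b_n greedily therefore kills a third of the remaining vectors,
-- and none is left after N steps as soon as their number is below (3/2)^N.
-- The slack between 1/20 and 1/10 makes compatibility a decidable condition on
-- the grid, which is what yields the index n constructively.

module Submission where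

open import Defs
import Algebra.Definitions.RawMonoid as RawMonoidDefs
open import Data.Fin using (Fin; toℕ; zero; suc; _↑ˡ_; fromℕ<; funToFin; finToFun)
import Data.Fin.Properties as Fin
open import Data.Integer as ℤ using (ℤ; +_; 1ℤ)
import Data.Integer.DivMod as ℤ
import Data.Integer.Divisibility.Signed as ℤ
import Data.Integer.Properties as ℤ
open import Data.Integer.Solver using () renaming (module +-*-Solver to ℤ-Solver)
open import Data.List using (List; []; _∷_; length; filter; allFin)
open import Data.List.Membership.Propositional using (_∈_)
open import Data.List.Membership.Propositional.Properties using (∈-filter⁺; ∈-allFin)
import Data.List.Properties as List
open import Data.Nat as ℕ using (ℕ; zero; suc)
import Data.Nat.Divisibility as ℕ
import Data.Nat.Properties as ℕ
open import Data.Nat.Solver using () renaming (module +-*-Solver to ℕ-Solver)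
open import Data.Product using (Σ-syntax; ∃-syntax; _×_; _,_; proj₁; proj₂; map₂)
open import Data.Rational as ℚ using (ℚ; 0ℚ; mkℚ; *≤*)
open import Data.Rational.Literals using (fromℤ)
import Data.Rational.Properties as ℚ
open import Data.Rational.Solver using () renaming (module +-*-Solver to ℚ-Solver)
open import Data.Sum using (inj₁; inj₂)
open import Data.Vec.Functional as Vector using (Vector)
open import Function using (_∘_; id)
open import Relation.Binary.PropositionalEquality
open import Relation.Nullary using (¬_; Dec; yes; no; contradiction)
open import Relation.Unary using (Decidable)

open RawMonoidDefs ℤ.+-0-rawMonoid using () renaming (sum to sumℤ)
open RawMonoidDefs ℚ.+-0-rawMonoid using () renaming (sum to sumℚ)

-- Greedy construction of a block that defeats finitely many candidates.

-- Double counting: by `excl` an entry passes at most two of the three tests, so it contributes at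
-- most 2 to the left side. The rewrites only bring the successors to the front.
length-filter₃ : ∀ {A : Set} {P Q R : A → Set}
  (P? : Decidable P) (Q? : Decidable Q) (R? : Decidable R) →
  (∀ a → P a → Q a → ¬ R a) → ∀ xs →
  length (filter P? xs) ℕ.+ (length (filter Q? xs) ℕ.+ length (filter R? xs)) ℕ.≤ length xs ℕ.* 2
length-filter₃ P? Q? R? excl [] = ℕ.z≤n
length-filter₃ P? Q? R? excl (x ∷ xs)
  with ih ← length-filter₃ P? Q? R? excl xs
  with P? x | Q? x | R? x
... | yes p | yes q | yes r = contradiction r (excl x p q)
... | no _  | no _  | no _  = ℕ.m≤n⇒m≤1+n (ℕ.m≤n⇒m≤1+n ih)
... | yes _ | no _  | no _  = ℕ.m≤n⇒m≤1+n (ℕ.s≤s ih)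
... | no _  | yes _ | no _
  rewrite ℕ.+-suc (length (filter P? xs)) (length (filter Q? xs) ℕ.+ length (filter R? xs))
  = ℕ.m≤n⇒m≤1+n (ℕ.s≤s ih)
... | no _  | no _  | yes _
  rewrite ℕ.+-suc (length (filter Q? xs)) (length (filter R? xs))
        | ℕ.+-suc (length (filter P? xs)) (length (filter Q? xs) ℕ.+ length (filter R? xs))
  = ℕ.m≤n⇒m≤1+n (ℕ.s≤s ih)
... | yes _ | yes _ | no _
  rewrite ℕ.+-suc (length (filter P? xs)) (length (filter Q? xs) ℕ.+ length (filter R? xs))
  = ℕ.s≤s (ℕ.s≤s ih)
... | yes _ | no _  | yes _
  rewrite ℕ.+-suc (length (filter Q? xs)) (length (filter R? xs))
        | ℕ.+-suc (length (filter P? xs)) (length (filter Q? xs) ℕ.+ length (filter R? xs))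
  = ℕ.s≤s (ℕ.s≤s ih)
... | no _  | yes _ | yes _
  rewrite ℕ.+-suc (length (filter Q? xs)) (length (filter R? xs))
        | ℕ.+-suc (length (filter P? xs)) (suc (length (filter Q? xs) ℕ.+ length (filter R? xs)))
        | ℕ.+-suc (length (filter P? xs)) (length (filter Q? xs) ℕ.+ length (filter R? xs))
  = ℕ.s≤s (ℕ.s≤s ih)

3*min≤sum : ∀ (f : Fin 3 → ℕ) → ∃[ j ] 3 ℕ.* f j ℕ.≤ f zero ℕ.+ (f (suc zero) ℕ.+ f (suc (suc zero)))
3*min≤sum f with ℕ.≤-total (f zero) (f (suc zero))
... | inj₁ p≤q with ℕ.≤-total (f zero) (f (suc (suc zero)))
...   | inj₁ p≤r = zero , ℕ.+-monoʳ-≤ (f zero) (ℕ.+-mono-≤ p≤q (ℕ.≤-trans (ℕ.≤-reflexive (ℕ.+-identityʳ _)) p≤r))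
...   | inj₂ r≤p = suc (suc zero) , ℕ.+-mono-≤ r≤p (ℕ.+-mono-≤ (ℕ.≤-trans r≤p p≤q) (ℕ.≤-reflexive (ℕ.+-identityʳ _)))
3*min≤sum f | inj₂ q≤p with ℕ.≤-total (f (suc zero)) (f (suc (suc zero)))
...   | inj₁ q≤r = suc zero , ℕ.+-mono-≤ q≤p (ℕ.+-monoʳ-≤ (f (suc zero)) (ℕ.≤-trans (ℕ.≤-reflexive (ℕ.+-identityʳ _)) q≤r))
...   | inj₂ r≤q = suc (suc zero) , ℕ.+-mono-≤ (ℕ.≤-trans r≤q q≤p) (ℕ.+-mono-≤ r≤q (ℕ.≤-reflexive (ℕ.+-identityʳ _)))

-- Induction on the length of the block. The value chosen first keeps at most two thirds of the
-- entries, so the bound on the count passes to the survivors with `N` lowered by one.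
avoiding-block : ∀ {A B : Set} (R : ℕ → A → B → Set) (R? : ∀ n a b → Dec (R n a b)) (c : Vector B 3) →
  (∀ n a → R n a (c zero) → R n a (c (suc zero)) → ¬ R n a (c (suc (suc zero)))) →
  ∀ N (xs : List A) → length xs ℕ.* 2 ℕ.^ N ℕ.< 3 ℕ.^ N →
  Σ[ b ∈ Vector B N ] (∀ {a} → a ∈ xs → ∃[ i ] ¬ R (toℕ i) a (b i))
-- For `N = 0` the count says `length xs < 1`, so the list is empty.
avoiding-block R R? c excl zero [] _ = Vector.[] , λ ()
avoiding-block R R? c excl zero (x ∷ xs) (ℕ.s≤s ())
avoiding-block {A} R R? c excl (suc N) xs few = c j Vector.∷ rest .proj₁ , hits
  where
  survivors : Fin 3 → List A
  survivors j = filter (λ a → R? 0 a (c j)) xs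

  choice = 3*min≤sum (λ j → length (survivors j))
  j = choice .proj₁

  3*survivors≤2*all : 3 ℕ.* length (survivors j) ℕ.≤ length xs ℕ.* 2
  3*survivors≤2*all = ℕ.≤-trans (choice .proj₂)
    (length-filter₃ (λ a → R? 0 a (c zero)) (λ a → R? 0 a (c (suc zero)))
      (λ a → R? 0 a (c (suc (suc zero)))) (excl 0) xs)

  fewer : length (survivors j) ℕ.* 2 ℕ.^ N ℕ.< 3 ℕ.^ N
  fewer = ℕ.*-cancelˡ-< 3 _ _ (begin-strict
    3 ℕ.* (length (survivors j) ℕ.* 2 ℕ.^ N) ≡⟨ ℕ.*-assoc 3 (length (survivors j)) _ ⟨
    3 ℕ.* length (survivors j) ℕ.* 2 ℕ.^ N   ≤⟨ ℕ.*-monoˡ-≤ (2 ℕ.^ N) 3*survivors≤2*all ⟩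
    length xs ℕ.* 2 ℕ.* 2 ℕ.^ N              ≡⟨ ℕ.*-assoc (length xs) 2 _ ⟩
    length xs ℕ.* 2 ℕ.^ suc N                <⟨ few ⟩
    3 ℕ.^ suc N                              ∎)
    where open ℕ.≤-Reasoning

  -- Position `i` of the rest is position `suc i` of the whole block, hence the shift of `R`.
  rest = avoiding-block (λ n → R (suc n)) (λ n → R? (suc n)) c (λ n → excl (suc n)) N (survivors j) fewer

  hits : ∀ {a} → a ∈ xs → ∃[ i ] ¬ R (toℕ i) a ((c j Vector.∷ rest .proj₁) i)
  hits {a} a∈xs with R? 0 a (c j)
  ... | no ¬r = zero , ¬r
  ... | yes r = let i , ¬ri = rest .proj₂ (∈-filter⁺ (λ a → R? 0 a (c j)) a∈xs r) in suc i , ¬ri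

-- Exponential growth against polynomial growth.

n<2^n : ∀ n → n ℕ.< 2 ℕ.^ n
n<2^n zero    = ℕ.s≤s ℕ.z≤n
n<2^n (suc n) = ℕ.+-mono-≤ (ℕ.m^n>0 2 n) (ℕ.≤-trans (n<2^n n) (ℕ.m≤m+n _ 0))

-- Squaring `n < 2 ^ n` supplies quadratic growth: with `g = a + 2b` and `e = 2g` the left side is
-- at most `g + g * g`, which is below `(g + 1)²` and so below `2 ^ g * 2 ^ g`.
linear<exponential : ∀ a b → ∃[ e ] a ℕ.+ e ℕ.* b ℕ.< 2 ℕ.^ e
linear<exponential a b = g ℕ.+ g , (begin-strict
  a ℕ.+ (g ℕ.+ g) ℕ.* b               ≤⟨ ℕ.+-monoˡ-≤ _ (ℕ.m≤m+n a (b ℕ.+ b)) ⟩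
  g ℕ.+ (g ℕ.+ g) ℕ.* b               ≡⟨ cong (g ℕ.+_) (solve 2 (λ g b → (g :+ g) :* b := g :* (b :+ b)) refl g b) ⟩
  g ℕ.+ g ℕ.* (b ℕ.+ b)               ≤⟨ ℕ.+-monoʳ-≤ g (ℕ.*-monoʳ-≤ g (ℕ.m≤n+m (b ℕ.+ b) a)) ⟩
  g ℕ.+ g ℕ.* g                       <⟨ ℕ.+-monoˡ-< (g ℕ.* g) (ℕ.n<1+n g) ⟩
  suc g ℕ.+ g ℕ.* g                   ≤⟨ ℕ.+-monoʳ-≤ (suc g) (ℕ.*-monoʳ-≤ g (ℕ.n≤1+n g)) ⟩
  suc g ℕ.* suc g                     ≤⟨ ℕ.*-mono-≤ (n<2^n g) (n<2^n g) ⟩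
  2 ℕ.^ g ℕ.* 2 ℕ.^ g                 ≡⟨ ℕ.^-distribˡ-+-* 2 g g ⟨
  2 ℕ.^ (g ℕ.+ g)                     ∎)
  where
  open ℕ.≤-Reasoning
  open ℕ-Solver
  g = a ℕ.+ (b ℕ.+ b)

-- Taking `N` to be a power of two and `c` below `2 ^ c` turns the left side into a power of 2. Its
-- exponent is below `3 * k` with `N = 2 * k`, because the polynomial factor has an exponent linear
-- in `e` while `k = 2 ^ e`. Then `8 ^ k ≤ 9 ^ k` finishes.
polynomial<exponential : ∀ c d r → ∃[ N ] 1 ℕ.≤ N × (c ℕ.* N ℕ.^ d) ℕ.^ r ℕ.* 2 ℕ.^ N ℕ.< 3 ℕ.^ N
polynomial<exponential c d r with e , h ← linear<exponential ((c ℕ.+ d) ℕ.* r) (d ℕ.* r) =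
  2 ℕ.^ suc e , ℕ.m^n>0 2 (suc e) , (begin-strict
  (c ℕ.* (2 ℕ.^ suc e) ℕ.^ d) ℕ.^ r ℕ.* 2 ℕ.^ N
    ≤⟨ ℕ.*-monoˡ-≤ (2 ℕ.^ N) (ℕ.^-monoˡ-≤ r (ℕ.*-monoˡ-≤ (N ℕ.^ d) (ℕ.<⇒≤ (n<2^n c)))) ⟩
  (2 ℕ.^ c ℕ.* (2 ℕ.^ suc e) ℕ.^ d) ℕ.^ r ℕ.* 2 ℕ.^ N
    ≡⟨ cong (λ t → (2 ℕ.^ c ℕ.* t) ℕ.^ r ℕ.* 2 ℕ.^ N) (ℕ.^-*-assoc 2 (suc e) d) ⟩
  (2 ℕ.^ c ℕ.* 2 ℕ.^ (suc e ℕ.* d)) ℕ.^ r ℕ.* 2 ℕ.^ N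
    ≡⟨ cong (λ t → t ℕ.^ r ℕ.* 2 ℕ.^ N) (ℕ.^-distribˡ-+-* 2 c (suc e ℕ.* d)) ⟨
  (2 ℕ.^ (c ℕ.+ suc e ℕ.* d)) ℕ.^ r ℕ.* 2 ℕ.^ N
    ≡⟨ cong (ℕ._* 2 ℕ.^ N) (ℕ.^-*-assoc 2 (c ℕ.+ suc e ℕ.* d) r) ⟩
  2 ℕ.^ ((c ℕ.+ suc e ℕ.* d) ℕ.* r) ℕ.* 2 ℕ.^ N
    ≡⟨ ℕ.^-distribˡ-+-* 2 ((c ℕ.+ suc e ℕ.* d) ℕ.* r) N ⟨
  2 ℕ.^ ((c ℕ.+ suc e ℕ.* d) ℕ.* r ℕ.+ N)
    <⟨ ℕ.^-monoʳ-< 2 (ℕ.s≤s (ℕ.s≤s ℕ.z≤n)) (ℕ.+-monoˡ-< N (ℕ.≤-<-trans (ℕ.≤-reflexive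
         (solve 4 (λ c d r e → (c :+ (d :+ e :* d)) :* r := (c :+ d) :* r :+ e :* (d :* r)) refl c d r e)) h)) ⟩
  -- Here `k + N` is `3 * k` by computation, as `N` unfolds to `2 * k`.
  2 ℕ.^ (3 ℕ.* k)
    ≡⟨ ℕ.^-*-assoc 2 3 k ⟨
  8 ℕ.^ k
    ≤⟨ ℕ.^-monoˡ-≤ k (ℕ.n≤1+n 8) ⟩
  9 ℕ.^ k
    ≡⟨ ℕ.^-*-assoc 3 2 k ⟩
  3 ℕ.^ N ∎)
  where
  open ℕ.≤-Reasoning
  open ℕ-Solver
  k = 2 ℕ.^ e
  N = 2 ℕ.^ suc e

-- Residue classes and the windows modulo `m`.

∣∧<⇒≡0 : ∀ {m n} → m ℕ.∣ n → n ℕ.< m → n ≡ 0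
∣∧<⇒≡0 {n = zero}  _   _   = refl
∣∧<⇒≡0 {n = suc _} m∣n n<m = contradiction m∣n (ℕ.>⇒∤ n<m)

-- The difference `b ∸ a` is divisible by `Q` and smaller than `Q`, hence zero.
residues-unique-≤ : ∀ {Q x a b} → a ℕ.≤ b → b ℕ.< a ℕ.+ Q →
  + Q ℤ.∣ x ℤ.- + a → + Q ℤ.∣ x ℤ.- + b → a ≡ b
residues-unique-≤ {Q} {x} {a} {b} a≤b b<a+Q Q∣x-a Q∣x-b =
  trans (sym (ℕ.+-identityʳ a)) (trans (cong (a ℕ.+_) (sym (∣∧<⇒≡0 Q∣t t<Q))) a+t≡b)
  where
  open ℤ-Solver
  t = b ℕ.∸ a

  a+t≡b : a ℕ.+ t ≡ b
  a+t≡b = ℕ.m+[n∸m]≡n a≤b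

  t<Q : t ℕ.< Q
  t<Q = ℕ.+-cancelˡ-< a _ _ (subst (ℕ._< a ℕ.+ Q) (sym a+t≡b) b<a+Q)

  Q∣t : Q ℕ.∣ t
  Q∣t = ℤ.∣⇒∣ᵤ {+ Q} {+ t} (subst (+ Q ℤ.∣_)
    (trans (cong (λ c → (x ℤ.- + a) ℤ.- (x ℤ.- + c)) (sym a+t≡b))
      (solve 3 (λ x a t → (x :- a) :- (x :- (a :+ t)) := t) refl x (+ a) (+ t)))
    (ℤ.∣m∣n⇒∣m-n Q∣x-a Q∣x-b))

residues-unique : ∀ {Q x a b} → b ℕ.< a ℕ.+ Q → a ℕ.< b ℕ.+ Q →
  + Q ℤ.∣ x ℤ.- + a → + Q ℤ.∣ x ℤ.- + b → a ≡ b
residues-unique {x = x} {a} {b} b<a+Q a<b+Q Q∣x-a Q∣x-b with ℕ.≤-total a b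
... | inj₁ a≤b = residues-unique-≤ {x = x} a≤b b<a+Q Q∣x-a Q∣x-b
... | inj₂ b≤a = sym (residues-unique-≤ {x = x} b≤a a<b+Q Q∣x-b Q∣x-a)

-- K / 20F, an approximation of P(n) up to 1/20, lies modulo m in the window
-- [b - 1/10, b + 1 + 1/10], as it must if ⌊P(n) + η⌋ ≡ b for some |η| ≤ 1/20.
Matches : (F m : ℕ) → ℤ → ℕ → Set
Matches F m K b = Σ[ r ∈ Fin (suc (24 ℕ.* F)) ]
  + (m ℕ.* (20 ℕ.* F)) ℤ.∣ (K ℤ.+ + (2 ℕ.* F)) ℤ.- + (b ℕ.* (20 ℕ.* F) ℕ.+ toℕ r)

matches? : ∀ F m K b → Dec (Matches F m K b)
matches? F m K b = Fin.any? λ r →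
  + (m ℕ.* (20 ℕ.* F)) ℤ.∣? ((K ℤ.+ + (2 ℕ.* F)) ℤ.- + (b ℕ.* (20 ℕ.* F) ℕ.+ toℕ r))

-- Consecutive windows start `20F` apart and have width `24F`, so their points differ by at most
-- `44F < 60F ≤ Q`, and congruent points of both are equal. A common residue of all three would thus
-- be one number, at most `24F` and at least `40F`. Passing through window 1 is essential: for
-- `m = 3` windows 0 and 2 do meet modulo `Q`, by wrapping around.
¬-matches-012 : ∀ F m .{{_ : ℕ.NonZero F}} → 3 ℕ.≤ m → ∀ K →
  Matches F m K 0 → Matches F m K 1 → ¬ Matches F m K 2
¬-matches-012 F m 3≤m K (r₀ , h₀) (r₁ , h₁) (r₂ , h₂) = ℕ.<-irrefl (trans a₀≡a₁ a₁≡a₂) (begin-strict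
  toℕ r₀                            ≤⟨ Fin.toℕ≤pred[n] r₀ ⟩
  24 ℕ.* F                          <⟨ ℕ.*-monoˡ-< F (ℕ.m≤m+n 25 15) ⟩
  40 ℕ.* F                          ≡⟨ ℕ.*-assoc 2 20 F ⟩
  2 ℕ.* (20 ℕ.* F)                  ≤⟨ ℕ.m≤m+n _ (toℕ r₂) ⟩
  2 ℕ.* (20 ℕ.* F) ℕ.+ toℕ r₂       ∎)
  where
  open ℕ.≤-Reasoning

  Q = m ℕ.* (20 ℕ.* F)
  a : ℕ → Fin (suc (24 ℕ.* F)) → ℕ
  a b r = b ℕ.* (20 ℕ.* F) ℕ.+ toℕ r

  44F<Q : 44 ℕ.* F ℕ.< Q
  44F<Q = begin-strict
    44 ℕ.* F           <⟨ ℕ.*-monoˡ-< F (ℕ.m≤m+n 45 15) ⟩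
    60 ℕ.* F           ≡⟨ ℕ.*-assoc 3 20 F ⟩
    3 ℕ.* (20 ℕ.* F)   ≤⟨ ℕ.*-monoˡ-≤ (20 ℕ.* F) 3≤m ⟩
    Q                  ∎

  up : ∀ b r s → a (suc b) s ℕ.< a b r ℕ.+ Q
  up b r s = begin-strict
    20 ℕ.* F ℕ.+ b ℕ.* (20 ℕ.* F) ℕ.+ toℕ s    ≡⟨ cong (ℕ._+ toℕ s) (ℕ.+-comm (20 ℕ.* F) (b ℕ.* (20 ℕ.* F))) ⟩
    b ℕ.* (20 ℕ.* F) ℕ.+ 20 ℕ.* F ℕ.+ toℕ s    ≡⟨ ℕ.+-assoc (b ℕ.* (20 ℕ.* F)) (20 ℕ.* F) (toℕ s) ⟩
    b ℕ.* (20 ℕ.* F) ℕ.+ (20 ℕ.* F ℕ.+ toℕ s)  ≤⟨ ℕ.+-mono-≤ (ℕ.m≤m+n (b ℕ.* (20 ℕ.* F)) (toℕ r)) (ℕ.+-monoʳ-≤ (20 ℕ.* F) (Fin.toℕ≤pred[n] s)) ⟩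
    a b r ℕ.+ (20 ℕ.* F ℕ.+ 24 ℕ.* F)          ≡⟨ cong (a b r ℕ.+_) (ℕ.*-distribʳ-+ F 20 24) ⟨
    a b r ℕ.+ 44 ℕ.* F                         <⟨ ℕ.+-monoʳ-< (a b r) 44F<Q ⟩
    a b r ℕ.+ Q                                ∎

  down : ∀ b r s → a b r ℕ.< a (suc b) s ℕ.+ Q
  down b r s = ℕ.+-mono-≤-<
    (ℕ.≤-trans (ℕ.m≤n+m _ (20 ℕ.* F)) (ℕ.m≤m+n _ (toℕ s)))
    (ℕ.≤-<-trans (Fin.toℕ≤pred[n] r) (ℕ.≤-<-trans (ℕ.*-monoˡ-≤ F (ℕ.m≤m+n 24 20)) 44F<Q))

  a₀≡a₁ : a 0 r₀ ≡ a 1 r₁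
  a₀≡a₁ = residues-unique {x = K ℤ.+ + (2 ℕ.* F)} (up 0 r₀ r₁) (down 0 r₀ r₁) h₀ h₁
  a₁≡a₂ : a 1 r₁ ≡ a 2 r₂
  a₁≡a₂ = residues-unique {x = K ℤ.+ + (2 ℕ.* F)} (up 1 r₁ r₂) (down 1 r₁ r₂) h₁ h₂

-- Allows the grid coefficients to be reduced modulo `Q`, which leaves finitely many candidates.
matches-cong : ∀ F m {K K′ b} → + (m ℕ.* (20 ℕ.* F)) ℤ.∣ K ℤ.- K′ → Matches F m K b → Matches F m K′ b
matches-cong F m {K} {K′} {b} Q∣K-K′ (r , h) = r , subst (+ (m ℕ.* (20 ℕ.* F)) ℤ.∣_)
  (solve 4 (λ k k′ f a → ((k :+ f) :- a) :- (k :- k′) := (k′ :+ f) :- a) refl K K′ (+ (2 ℕ.* F)) (+ (b ℕ.* (20 ℕ.* F) ℕ.+ toℕ r)))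
  (ℤ.∣m∣n⇒∣m-n h Q∣K-K′)
  where open ℤ-Solver

-- The witness `r` is the distance of `K + 2F` above `k * M`. Subtracting it leaves `(k - b) * M`,
-- which `m * M` divides.
matches-window : ∀ F m {K k b} → + m ℤ.∣ k ℤ.- + b →
  k ℤ.* + (20 ℕ.* F) ℤ.≤ K ℤ.+ + (2 ℕ.* F) →
  K ℤ.+ + (2 ℕ.* F) ℤ.≤ k ℤ.* + (20 ℕ.* F) ℤ.+ + (24 ℕ.* F) →
  Matches F m K b
matches-window F m {K} {k} {b} m∣k-b lower upper = r , divides
  where
  open ℤ-Solver
  M = + (20 ℕ.* F)
  gap : ℤ
  gap = (K ℤ.+ + (2 ℕ.* F)) ℤ.- k ℤ.* M

  +∣gap∣≡gap : + ℤ.∣ gap ∣ ≡ gap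
  +∣gap∣≡gap = ℤ.0≤i⇒+∣i∣≡i (ℤ.i≤j⇒0≤j-i lower)

  ∣gap∣≤24F : ℤ.∣ gap ∣ ℕ.≤ 24 ℕ.* F
  ∣gap∣≤24F = ℤ.drop‿+≤+ (subst₂ ℤ._≤_ (sym +∣gap∣≡gap)
    (solve 2 (λ a b → (a :+ b) :- a := b) refl (k ℤ.* M) (+ (24 ℕ.* F)))
    (ℤ.+-monoˡ-≤ (ℤ.- (k ℤ.* M)) upper))

  r : Fin (suc (24 ℕ.* F))
  r = fromℕ< (ℕ.s≤s ∣gap∣≤24F)

  x-bM-r≡[k-b]M : (K ℤ.+ + (2 ℕ.* F)) ℤ.- + (b ℕ.* (20 ℕ.* F) ℕ.+ toℕ r) ≡ (k ℤ.- + b) ℤ.* M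
  x-bM-r≡[k-b]M = begin
    x ℤ.- (+ (b ℕ.* (20 ℕ.* F)) ℤ.+ + toℕ r)
      ≡⟨ cong₂ (λ u v → x ℤ.- (u ℤ.+ v)) (ℤ.pos-* b (20 ℕ.* F))
           (trans (cong +_ (Fin.toℕ-fromℕ< (ℕ.s≤s ∣gap∣≤24F))) +∣gap∣≡gap) ⟩
    x ℤ.- (+ b ℤ.* M ℤ.+ (x ℤ.- k ℤ.* M))
      ≡⟨ solve 4 (λ x b k M → x :- (b :* M :+ (x :- k :* M)) := (k :- b) :* M) refl x (+ b) k M ⟩
    (k ℤ.- + b) ℤ.* M ∎
    where
    open ≡-Reasoning
    x = K ℤ.+ + (2 ℕ.* F)

  divides : + (m ℕ.* (20 ℕ.* F)) ℤ.∣ (K ℤ.+ + (2 ℕ.* F)) ℤ.- + (b ℕ.* (20 ℕ.* F) ℕ.+ toℕ r)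
  divides = subst₂ ℤ._∣_ (sym (ℤ.pos-* m (20 ℕ.* F))) (sym x-bM-r≡[k-b]M) (ℤ.*-monoˡ-∣ M m∣k-b)

-- Integers as rationals, and rounding of reals to a grid.

-- Opaque, so that sums and products of casts do not compute and arguments
-- can be inferred from them.
opaque
  int : ℤ → ℚ
  int = fromℤ

  int≡fromℤ : ∀ k → int k ≡ fromℤ k
  int≡fromℤ k = refl

  int-+ : ∀ k l → int (k ℤ.+ l) ≡ int k ℚ.+ int l
  int-+ k l = sym (trans
    (cong (ℚ._/ 1) (cong₂ ℤ._+_ (ℤ.*-identityʳ k) (ℤ.*-identityʳ l)))
    (ℚ.↥p/↧p≡p (fromℤ (k ℤ.+ l))))

  int-* : ∀ k l → int (k ℤ.* l) ≡ int k ℚ.* int l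
  int-* k l = sym (ℚ.↥p/↧p≡p (fromℤ (k ℤ.* l)))

  int-mono-≤ : ∀ {k l} → k ℤ.≤ l → int k ℚ.≤ int l
  int-mono-≤ {k} {l} k≤l =
    *≤* (subst₂ ℤ._≤_ (sym (ℤ.*-identityʳ k)) (sym (ℤ.*-identityʳ l)) k≤l)

  int-cancel-≤ : ∀ {k l} → int k ℚ.≤ int l → k ℤ.≤ l
  int-cancel-≤ {k} {l} (*≤* k≤l) = subst₂ ℤ._≤_ (ℤ.*-identityʳ k) (ℤ.*-identityʳ l) k≤l

  floor-bounds : ∀ p → ∃[ k ] int k ℚ.≤ p × p ℚ.≤ int (1ℤ ℤ.+ k)
  floor-bounds (mkℚ n d-1 _) = n ℤ./ℕ suc d-1
    , *≤* (subst (n ℤ./ℕ suc d-1 ℤ.* + suc d-1 ℤ.≤_) (sym (ℤ.*-identityʳ n)) (ℤ.[n/ℕd]*d≤n n (suc d-1)))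
    , *≤* (subst (ℤ._≤ ℤ.suc (n ℤ./ℕ suc d-1) ℤ.* + suc d-1) (sym (ℤ.*-identityʳ n)) (ℤ.<⇒≤ (ℤ.n<s[n/ℕd]*d n (suc d-1))))

  nonNegative-int : ∀ n → ℚ.NonNegative (int (+ n))
  nonNegative-int n = _

  reciprocal : ∀ n .{{_ : ℕ.NonZero n}} → ∃[ ε ] 0ℚ ℚ.< ε × int (+ n) ℚ.* ε ≡ int 1ℤ
  reciprocal (suc n) =
    ℚ.1/ fromℤ (+ suc n) , ℚ.positive⁻¹ (ℚ.1/ fromℤ (+ suc n)) , ℚ.*-inverseʳ (fromℤ (+ suc n))

scale : ℕ → ℚ
scale n = int (+ n)

scale-* : ∀ n {p q} → p ℚ.≤ q → scale n ℚ.* p ℚ.≤ scale n ℚ.* q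
scale-* n = ℚ.*-monoˡ-≤-nonNeg (scale n) {{nonNegative-int n}}

p≤∣p∣ : ∀ p → p ℚ.≤ ℚ.∣ p ∣
p≤∣p∣ p with ℚ.≤-total 0ℚ p
... | inj₁ 0≤p = ℚ.≤-reflexive (sym (ℚ.0≤p⇒∣p∣≡p 0≤p))
... | inj₂ p≤0 = ℚ.≤-trans p≤0 (ℚ.0≤∣p∣ p)

-p≤∣p∣ : ∀ p → ℚ.- p ℚ.≤ ℚ.∣ p ∣
-p≤∣p∣ p = subst (ℚ.- p ℚ.≤_) (ℚ.∣-p∣≡∣p∣ p) (p≤∣p∣ (ℚ.- p))

∣p-q∣<ε⇒p≤q+ε : ∀ {p q ε} → ℚ.∣ p ℚ.- q ∣ ℚ.< ε → p ℚ.≤ q ℚ.+ ε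
∣p-q∣<ε⇒p≤q+ε {p} {q} {ε} h = begin
  p                    ≡⟨ solve 2 (λ p q → p := q :+ (p :- q)) refl p q ⟩
  q ℚ.+ (p ℚ.- q)      ≤⟨ ℚ.+-monoʳ-≤ q (ℚ.≤-trans (p≤∣p∣ (p ℚ.- q)) (ℚ.<⇒≤ h)) ⟩
  q ℚ.+ ε              ∎
  where open ℚ.≤-Reasoning; open ℚ-Solver

-- A real has no computable floor, so one rational term is rounded, taken where the tail stays
-- within `1/M` of it. Scaled by `M`, this costs 1 for the tail and at most 1 for the floor. The
-- threshold is kept since the bounds hold only from there on.
nearest : ∀ M .{{_ : ℕ.NonZero M}} x → Σ[ k ∈ ℤ ] ∃[ I ] ∀ i → I ℕ.≤ i →
  scale M ℚ.* seq x i ℚ.≤ int (k ℤ.+ + 2) × int k ℚ.≤ scale M ℚ.* seq x i ℚ.+ int (+ 2)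
nearest M x =
  let ε , 0<ε , Mε≡1 = reciprocal M
      I , close      = cauchy x ε 0<ε
      xI             = seq x I
      k , k≤ , ≤1+k  = floor-bounds (scale M ℚ.* xI)
      M[y+ε]≡ : ∀ y → scale M ℚ.* (y ℚ.+ ε) ≡ scale M ℚ.* y ℚ.+ int 1ℤ
      M[y+ε]≡ y = trans (ℚ.*-distribˡ-+ (scale M) y ε) (cong (scale M ℚ.* y ℚ.+_) Mε≡1)
  in k , I , λ i i≥I →
    (begin
      scale M ℚ.* seq x i                ≤⟨ scale-* M (∣p-q∣<ε⇒p≤q+ε {seq x i} {xI} (close i I i≥I ℕ.≤-refl)) ⟩
      scale M ℚ.* (xI ℚ.+ ε)             ≡⟨ M[y+ε]≡ xI ⟩
      scale M ℚ.* xI ℚ.+ int 1ℤ          ≤⟨ ℚ.+-monoˡ-≤ (int 1ℤ) ≤1+k ⟩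
      int (1ℤ ℤ.+ k) ℚ.+ int 1ℤ          ≡⟨ int-+ (1ℤ ℤ.+ k) 1ℤ ⟨
      int (1ℤ ℤ.+ k ℤ.+ 1ℤ)              ≡⟨ cong int (trans (cong (ℤ._+ 1ℤ) (ℤ.+-comm 1ℤ k)) (ℤ.+-assoc k 1ℤ 1ℤ)) ⟩
      int (k ℤ.+ + 2)                    ∎)
  , (begin
      int k                              ≤⟨ k≤ ⟩
      scale M ℚ.* xI                     ≤⟨ scale-* M (∣p-q∣<ε⇒p≤q+ε {xI} {seq x i} (close I i ℕ.≤-refl i≥I)) ⟩
      scale M ℚ.* (seq x i ℚ.+ ε)        ≡⟨ M[y+ε]≡ (seq x i) ⟩
      -- Error 1 would do on this side; 2 makes both bounds symmetric.
      scale M ℚ.* seq x i ℚ.+ int 1ℤ     ≤⟨ ℚ.+-monoʳ-≤ (scale M ℚ.* seq x i) (int-mono-≤ {1ℤ} {+ 2} (ℤ.+≤+ (ℕ.s≤s ℕ.z≤n))) ⟩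
      scale M ℚ.* seq x i ℚ.+ int (+ 2)  ∎)
  where open ℚ.≤-Reasoning

eventually-all : ∀ {r} {P : Fin r → ℕ → Set} → (∀ j → ∃[ I ] ∀ i → I ℕ.≤ i → P j i) →
  ∃[ I ] ∀ i → I ℕ.≤ i → ∀ j → P j i
eventually-all {zero}  h = 0 , λ _ _ ()
eventually-all {suc r} h =
  let I , hI = h zero
      J , hJ = eventually-all (h ∘ suc)
  in I ℕ.⊔ J , λ where
    i i≥ zero    → hI i (ℕ.m⊔n≤o⇒m≤o I J i≥)
    i i≥ (suc j) → hJ i (ℕ.m⊔n≤o⇒n≤o I J i≥) j

-- Propagation of the rounding error from coefficients to values.

seq-^ : ∀ n e i → seq (ℕ→ℝ n ^ e) i ≡ int (+ (n ℕ.^ e))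
seq-^ n zero    i = sym (int≡fromℤ 1ℤ)
seq-^ n (suc e) i = trans (cong₂ ℚ._*_ (sym (int≡fromℤ (+ n))) (seq-^ n e i))
  (trans (sym (int-* (+ n) (+ (n ℕ.^ e)))) (cong int (sym (ℤ.pos-* n (n ℕ.^ e)))))

-- The exponents are a separate argument, so that removing the first coefficient leaves a sum of the
-- same form; for a polynomial they are `toℕ`.
evalℤ : ∀ {r} → Vector ℤ r → (Fin r → ℕ) → ℕ → ℤ
evalℤ k e n = sumℤ (λ j → k j ℤ.* + (n ℕ.^ e j))

evalℚ : ∀ {r} → Vector ℚ r → (Fin r → ℕ) → ℕ → ℚ
evalℚ c e n = sumℚ (λ j → c j ℚ.* scale (n ℕ.^ e j))

seq-sum : ∀ {r} (x : Vector ℝ r) (q : Vector ℚ r) i → (∀ j → seq (x j) i ≡ q j) → seq (sum x) i ≡ sumℚ q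
seq-sum {zero}  x q i x≡q = refl
seq-sum {suc r} x q i x≡q = cong₂ ℚ._+_ (x≡q zero) (seq-sum (λ j → x (suc j)) (λ j → q (suc j)) i (λ j → x≡q (suc j)))

seq-eval : ∀ {d} (P : Polynomial d) n i → seq (eval P (ℕ→ℝ n)) i ≡ evalℚ (λ j → seq (coeff P j) i) toℕ n
seq-eval P n i = cong₂ ℚ._+_
  (cong (seq (coeff P zero) i ℚ.*_) (seq-^ n 0 i))
  (seq-sum _ (λ j → seq (coeff P (suc j)) i ℚ.* scale (n ℕ.^ suc (toℕ j))) i
    (λ j → cong (seq (coeff P (suc j)) i ℚ.*_) (seq-^ n (suc (toℕ j)) i)))

module _ (M n W : ℕ) where
  private
    open ℚ.≤-Reasoning

    collect : ∀ w k K E → w ℤ.* (k ℤ.+ + 2) ℤ.+ (K ℤ.+ E) ≡ (k ℤ.* w ℤ.+ K) ℤ.+ (+ 2 ℤ.* w ℤ.+ E)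
    collect = solve 4 (λ w k K E →
      w :* (k :+ con (+ 2)) :+ (K :+ E) := (k :* w :+ K) :+ (con (+ 2) :* w :+ E)) refl
      where open ℤ-Solver

    add-term-≤ : ∀ {w} k K E {c s} → w ℕ.≤ W →
      scale M ℚ.* c ℚ.≤ int (k ℤ.+ + 2) → scale M ℚ.* s ℚ.≤ int (K ℤ.+ + E) →
      scale M ℚ.* (c ℚ.* scale w ℚ.+ s) ℚ.≤ int ((k ℤ.* + w ℤ.+ K) ℤ.+ + (2 ℕ.* W ℕ.+ E))
    add-term-≤ {w} k K E {c} {s} w≤W c≤ s≤ = begin
      scale M ℚ.* (c ℚ.* scale w ℚ.+ s)
        ≡⟨ solve 4 (λ M c w s → M :* (c :* w :+ s) := w :* (M :* c) :+ M :* s) refl (scale M) c (scale w) s ⟩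
      scale w ℚ.* (scale M ℚ.* c) ℚ.+ scale M ℚ.* s
        ≤⟨ ℚ.+-mono-≤ (scale-* w c≤) s≤ ⟩
      scale w ℚ.* int (k ℤ.+ + 2) ℚ.+ int (K ℤ.+ + E)
        ≡⟨ cong (ℚ._+ int (K ℤ.+ + E)) (int-* (+ w) (k ℤ.+ + 2)) ⟨
      int (+ w ℤ.* (k ℤ.+ + 2)) ℚ.+ int (K ℤ.+ + E)
        ≡⟨ int-+ (+ w ℤ.* (k ℤ.+ + 2)) (K ℤ.+ + E) ⟨
      int (+ w ℤ.* (k ℤ.+ + 2) ℤ.+ (K ℤ.+ + E))
        ≡⟨ cong int (collect (+ w) k K (+ E)) ⟩
      int ((k ℤ.* + w ℤ.+ K) ℤ.+ (+ 2 ℤ.* + w ℤ.+ + E))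
        ≡⟨ cong (λ t → int ((k ℤ.* + w ℤ.+ K) ℤ.+ (t ℤ.+ + E))) (ℤ.pos-* 2 w) ⟨
      int ((k ℤ.* + w ℤ.+ K) ℤ.+ + (2 ℕ.* w ℕ.+ E))
        ≤⟨ int-mono-≤ (ℤ.+-monoʳ-≤ (k ℤ.* + w ℤ.+ K) (ℤ.+≤+ (ℕ.+-monoˡ-≤ E (ℕ.*-monoʳ-≤ 2 w≤W)))) ⟩
      int ((k ℤ.* + w ℤ.+ K) ℤ.+ + (2 ℕ.* W ℕ.+ E)) ∎
      where open ℚ-Solver

    ≤-add-term : ∀ {w} k K E {c s} → w ℕ.≤ W →
      int k ℚ.≤ scale M ℚ.* c ℚ.+ scale 2 → int K ℚ.≤ scale M ℚ.* s ℚ.+ scale E →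
      int (k ℤ.* + w ℤ.+ K) ℚ.≤ scale M ℚ.* (c ℚ.* scale w ℚ.+ s) ℚ.+ scale (2 ℕ.* W ℕ.+ E)
    ≤-add-term {w} k K E {c} {s} w≤W ≤c ≤s = begin
      int (k ℤ.* + w ℤ.+ K)
        ≡⟨ int-+ (k ℤ.* + w) K ⟩
      int (k ℤ.* + w) ℚ.+ int K
        ≡⟨ cong (ℚ._+ int K) (trans (cong int (ℤ.*-comm k (+ w))) (int-* (+ w) k)) ⟩
      scale w ℚ.* int k ℚ.+ int K
        ≤⟨ ℚ.+-mono-≤ (scale-* w ≤c) ≤s ⟩
      scale w ℚ.* (scale M ℚ.* c ℚ.+ scale 2) ℚ.+ (scale M ℚ.* s ℚ.+ scale E)
        ≡⟨ solve 6 (λ M c w s t E → w :* (M :* c :+ t) :+ (M :* s :+ E) := M :* (c :* w :+ s) :+ (t :* w :+ E))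
             refl (scale M) c (scale w) s (scale 2) (scale E) ⟩
      scale M ℚ.* (c ℚ.* scale w ℚ.+ s) ℚ.+ (scale 2 ℚ.* scale w ℚ.+ scale E)
        ≤⟨ ℚ.+-monoʳ-≤ (scale M ℚ.* (c ℚ.* scale w ℚ.+ s)) (ℚ.+-monoˡ-≤ (scale E)
             (scale-* 2 (int-mono-≤ (ℤ.+≤+ w≤W)))) ⟩
      scale M ℚ.* (c ℚ.* scale w ℚ.+ s) ℚ.+ (scale 2 ℚ.* scale W ℚ.+ scale E)
        ≡⟨ cong (λ u → scale M ℚ.* (c ℚ.* scale w ℚ.+ s) ℚ.+ (u ℚ.+ scale E))
             (trans (cong int (ℤ.pos-* 2 W)) (int-* (+ 2) (+ W))) ⟨
      scale M ℚ.* (c ℚ.* scale w ℚ.+ s) ℚ.+ (scale (2 ℕ.* W) ℚ.+ scale E)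
        ≡⟨ cong (scale M ℚ.* (c ℚ.* scale w ℚ.+ s) ℚ.+_) (int-+ (+ (2 ℕ.* W)) (+ E)) ⟨
      scale M ℚ.* (c ℚ.* scale w ℚ.+ s) ℚ.+ scale (2 ℕ.* W ℕ.+ E) ∎
      where open ℚ-Solver

  -- Each of the `r` coefficients is off by at most 2 and is multiplied by a power of `n` that is at
  -- most `W`, so the total error is at most `r * (2 * W)`.
  eval-≤ : ∀ {r} (c : Vector ℚ r) (k : Vector ℤ r) (e : Fin r → ℕ) →
    (∀ j → n ℕ.^ e j ℕ.≤ W) → (∀ j → scale M ℚ.* c j ℚ.≤ int (k j ℤ.+ + 2)) →
    scale M ℚ.* evalℚ c e n ℚ.≤ int (evalℤ k e n ℤ.+ + (r ℕ.* (2 ℕ.* W)))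
  eval-≤ {zero}  c k e n^e≤W c≤k =
    ℚ.≤-reflexive (trans (ℚ.*-zeroʳ (scale M)) (sym (int≡fromℤ (+ 0))))
  eval-≤ {suc r} c k e n^e≤W c≤k =
    add-term-≤ (k zero) (evalℤ (λ j → k (suc j)) (λ j → e (suc j)) n) (r ℕ.* (2 ℕ.* W)) (n^e≤W zero)
      (c≤k zero)
      (eval-≤ (λ j → c (suc j)) (λ j → k (suc j)) (λ j → e (suc j)) (λ j → n^e≤W (suc j)) (λ j → c≤k (suc j)))

  ≤-eval : ∀ {r} (c : Vector ℚ r) (k : Vector ℤ r) (e : Fin r → ℕ) →
    (∀ j → n ℕ.^ e j ℕ.≤ W) → (∀ j → int (k j) ℚ.≤ scale M ℚ.* c j ℚ.+ scale 2) →
    int (evalℤ k e n) ℚ.≤ scale M ℚ.* evalℚ c e n ℚ.+ scale (r ℕ.* (2 ℕ.* W))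
  ≤-eval {zero}  c k e n^e≤W k≤c = ℚ.≤-reflexive (sym
    (trans (cong (ℚ._+ int (+ 0)) (ℚ.*-zeroʳ (scale M))) (ℚ.+-identityˡ (int (+ 0)))))
  ≤-eval {suc r} c k e n^e≤W k≤c =
    ≤-add-term (k zero) (evalℤ (λ j → k (suc j)) (λ j → e (suc j)) n) (r ℕ.* (2 ℕ.* W)) (n^e≤W zero)
      (k≤c zero)
      (≤-eval (λ j → c (suc j)) (λ j → k (suc j)) (λ j → e (suc j)) (λ j → n^e≤W (suc j)) (λ j → k≤c (suc j)))

evalℤ-cong-∣ : ∀ {r q} {k l : Vector ℤ r} e n → (∀ j → q ℤ.∣ k j ℤ.- l j) → q ℤ.∣ evalℤ k e n ℤ.- evalℤ l e n
evalℤ-cong-∣ {zero}  {q} e n h = ℤ.divides (+ 0) refl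
evalℤ-cong-∣ {suc r} {q} {k} {l} e n h = subst (q ℤ.∣_)
  (solve 5 (λ a b w s t → (a :- b) :* w :+ (s :- t) := (a :* w :+ s) :- (b :* w :+ t)) refl
    (k zero) (l zero) (+ (n ℕ.^ e zero)) (evalℤ (k ∘ suc) (e ∘ suc) n) (evalℤ (l ∘ suc) (e ∘ suc) n))
  (ℤ.∣m∣n⇒∣m+n (ℤ.∣m⇒∣m*n (+ (n ℕ.^ e zero)) (h zero)) (evalℤ-cong-∣ {k = k ∘ suc} {l ∘ suc} (e ∘ suc) n (h ∘ suc)))
  where open ℤ-Solver

-- From floors of perturbed values to windows.

module _ (F : ℕ) where
  private
    open ℚ.≤-Reasoning

    M = 20 ℕ.* F

    expand : ∀ M k f → M ℤ.* (k ℤ.+ 1ℤ) ℤ.+ f ≡ k ℤ.* M ℤ.+ (M ℤ.+ f)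
    expand = solve 3 (λ M k f → M :* (k :+ con 1ℤ) :+ f := k :* M :+ (M :+ f)) refl
      where open ℤ-Solver

    open ℚ-Solver

    opaque
      -- Unfolded so that `int (+ 20)` times `1/20` computes to 1.
      unfolding int

      M/20≡F : scale M ℚ.* (+ 1 ℚ./ 20) ≡ scale F
      M/20≡F = trans (cong (ℚ._* (+ 1 ℚ./ 20)) (trans (cong int (ℤ.pos-* 20 F)) (int-* (+ 20) (+ F))))
        (trans (swap (int (+ 20)) (int (+ F)) (+ 1 ℚ./ 20)) (ℚ.*-identityˡ (int (+ F))))
        where
        swap : ∀ a b c → (a ℚ.* b) ℚ.* c ≡ (a ℚ.* c) ℚ.* b
        swap = solve 3 (λ a b c → (a :* b) :* c := (a :* c) :* b) refl

    -- Here `h` is a term of the perturbation, `v` is 1/20 and `ε` is `1/M`. After scaling, `v`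
    -- costs `F` and each of the two `ε` costs 1.
    lower : ∀ k {y h v ε} → scale M ℚ.* ε ≡ scale 1 → scale M ℚ.* v ≡ scale F →
      h ℚ.≤ v ℚ.+ ε → int k ℚ.≤ (y ℚ.+ h) ℚ.+ ε →
      int (k ℤ.* + M) ℚ.≤ scale M ℚ.* y ℚ.+ scale (F ℕ.+ 2)
    lower k {y} {h} {v} {ε} Mε≡1 Mv≡F h≤ k≤ = begin
      int (k ℤ.* + M)
        ≡⟨ trans (cong int (ℤ.*-comm k (+ M))) (int-* (+ M) k) ⟩
      scale M ℚ.* int k
        ≤⟨ scale-* M (ℚ.≤-trans k≤ (ℚ.+-monoˡ-≤ ε (ℚ.+-monoʳ-≤ y h≤))) ⟩
      scale M ℚ.* ((y ℚ.+ (v ℚ.+ ε)) ℚ.+ ε)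
        ≡⟨ solve 4 (λ M y v e → M :* ((y :+ (v :+ e)) :+ e) := M :* y :+ (M :* v :+ (M :* e :+ M :* e))) refl
             (scale M) y v ε ⟩
      scale M ℚ.* y ℚ.+ (scale M ℚ.* v ℚ.+ (scale M ℚ.* ε ℚ.+ scale M ℚ.* ε))
        ≡⟨ cong₂ (λ s t → scale M ℚ.* y ℚ.+ (s ℚ.+ (t ℚ.+ t))) Mv≡F Mε≡1 ⟩
      scale M ℚ.* y ℚ.+ (scale F ℚ.+ (scale 1 ℚ.+ scale 1))
        ≡⟨ cong (λ t → scale M ℚ.* y ℚ.+ (scale F ℚ.+ t)) (int-+ (+ 1) (+ 1)) ⟨
      scale M ℚ.* y ℚ.+ (scale F ℚ.+ scale 2)
        ≡⟨ cong (scale M ℚ.* y ℚ.+_) (int-+ (+ F) (+ 2)) ⟨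
      scale M ℚ.* y ℚ.+ scale (F ℕ.+ 2) ∎

    -- Only one `ε` is lost here: the strict upper bound in `IsFloor` comes with its own positive
    -- margin, which absorbs the other.
    upper : ∀ k {y h v ε} → scale M ℚ.* ε ≡ scale 1 → scale M ℚ.* v ≡ scale F →
      ℚ.- h ℚ.≤ v ℚ.+ ε → y ℚ.+ h ℚ.≤ int (k ℤ.+ 1ℤ) →
      scale M ℚ.* y ℚ.≤ int (k ℤ.* + M ℤ.+ + (M ℕ.+ (F ℕ.+ 1)))
    upper k {y} {h} {v} {ε} Mε≡1 Mv≡F -h≤ ≤k+1 = begin
      scale M ℚ.* y
        ≡⟨ cong (scale M ℚ.*_) (solve 2 (λ y h → y := (y :+ h) :+ (:- h)) refl y h) ⟩
      scale M ℚ.* ((y ℚ.+ h) ℚ.+ ℚ.- h)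
        ≤⟨ scale-* M (ℚ.+-mono-≤ ≤k+1 -h≤) ⟩
      scale M ℚ.* (int (k ℤ.+ 1ℤ) ℚ.+ (v ℚ.+ ε))
        ≡⟨ solve 4 (λ M k v e → M :* (k :+ (v :+ e)) := M :* k :+ (M :* v :+ M :* e)) refl
             (scale M) (int (k ℤ.+ 1ℤ)) v ε ⟩
      scale M ℚ.* int (k ℤ.+ 1ℤ) ℚ.+ (scale M ℚ.* v ℚ.+ scale M ℚ.* ε)
        ≡⟨ cong₂ ℚ._+_ (sym (int-* (+ M) (k ℤ.+ 1ℤ))) (trans (cong₂ ℚ._+_ Mv≡F Mε≡1) (sym (int-+ (+ F) 1ℤ))) ⟩
      int (+ M ℤ.* (k ℤ.+ 1ℤ)) ℚ.+ scale (F ℕ.+ 1)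
        ≡⟨ int-+ (+ M ℤ.* (k ℤ.+ 1ℤ)) (+ (F ℕ.+ 1)) ⟨
      int (+ M ℤ.* (k ℤ.+ 1ℤ) ℤ.+ + (F ℕ.+ 1))
        ≡⟨ cong int (expand (+ M) k (+ (F ℕ.+ 1))) ⟩
      int (k ℤ.* + M ℤ.+ + (M ℕ.+ (F ℕ.+ 1))) ∎

  -- Turns the relations on reals into rational inequalities from some index on, which can be
  -- compared with those of `nearest`.
  floor-window : .{{_ : ℕ.NonZero F}} → ∀ {y η k} → ∣ η ∣ ≤ fromℚ (+ 1 ℚ./ 20) → IsFloor (y + η) k →
    ∃[ I ] ∀ i → I ℕ.≤ i →
      int (k ℤ.* + (20 ℕ.* F)) ℚ.≤ scale (20 ℕ.* F) ℚ.* seq y i ℚ.+ scale (F ℕ.+ 2) ×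
      scale (20 ℕ.* F) ℚ.* seq y i ℚ.≤ int (k ℤ.* + (20 ℕ.* F) ℤ.+ + (20 ℕ.* F ℕ.+ (F ℕ.+ 1)))
  floor-window {y} {η} {k} ∣η∣≤ (k≤ , ε′ , 0<ε′ , C , <k+1) =
    let ε , 0<ε , Mε≡1 = reciprocal M {{ℕ.m*n≢0 20 F}}
        A , ηsmall = ∣η∣≤ ε 0<ε
        B , k≤y+η = k≤ ε 0<ε
    in A ℕ.⊔ (B ℕ.⊔ C) , λ i i≥ →
      let i≥BC = ℕ.m⊔n≤o⇒n≤o A (B ℕ.⊔ C) i≥
          ∣ηi∣≤ = ηsmall i (ℕ.m⊔n≤o⇒m≤o A (B ℕ.⊔ C) i≥)
          k≤yi = k≤y+η i (ℕ.m⊔n≤o⇒m≤o B C i≥BC)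
          yi≤ = <k+1 i (ℕ.m⊔n≤o⇒n≤o B C i≥BC)
      in lower k {seq y i} {seq η i} Mε≡1 M/20≡F (ℚ.≤-trans (p≤∣p∣ (seq η i)) ∣ηi∣≤)
           (subst (ℚ._≤ seq y i ℚ.+ seq η i ℚ.+ ε) (sym (int≡fromℤ k)) k≤yi)
       , upper k {seq y i} {seq η i} Mε≡1 M/20≡F (ℚ.≤-trans (-p≤∣p∣ (seq η i)) ∣ηi∣≤)
           (subst (seq y i ℚ.+ seq η i ℚ.≤_) (sym (int≡fromℤ (k ℤ.+ 1ℤ))) (ℚ.≤-trans (p≤p+q 0<ε′) yi≤))
    where
    p≤p+q : ∀ {p q} → 0ℚ ℚ.< q → p ℚ.≤ p ℚ.+ q
    p≤p+q {p} 0<q = ℚ.≤-trans (ℚ.≤-reflexive (sym (ℚ.+-identityʳ p))) (ℚ.+-monoʳ-≤ p (ℚ.<⇒≤ 0<q))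

-- The margin `2F`, which is 1/10 in units of `M`, splits in two: one `F` pays for the perturbation,
-- and the other covers the rounding error `E` together with the additive constants, by `E + 2 ≤ F`.
near-matches : ∀ F m {K κ b E y} → E ℕ.+ 2 ℕ.≤ F → κ ≡ + b [mod m ] →
  int (κ ℤ.* + (20 ℕ.* F)) ℚ.≤ y ℚ.+ scale (F ℕ.+ 2) →
  y ℚ.≤ int (κ ℤ.* + (20 ℕ.* F) ℤ.+ + (20 ℕ.* F ℕ.+ (F ℕ.+ 1))) →
  y ℚ.≤ int (K ℤ.+ + E) → int K ℚ.≤ y ℚ.+ scale E →
  Matches F m K b
near-matches F m {K} {κ} {b} {E} E+2≤F κ≡b κ≤y y≤κ y≤K K≤y =
  matches-window F m {K} {κ} {b} (ℤ.∣ᵤ⇒∣ κ≡b)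
    (below (int-cancel-≤ (ℚ.≤-trans κ≤y (ℚ.≤-trans (ℚ.+-monoˡ-≤ (scale (F ℕ.+ 2)) y≤K)
      (ℚ.≤-reflexive (sym (int-+ (K ℤ.+ + E) (+ (F ℕ.+ 2)))))))))
    (above (int-cancel-≤ (ℚ.≤-trans K≤y (ℚ.≤-trans (ℚ.+-monoˡ-≤ (scale E) y≤κ)
      (ℚ.≤-reflexive (sym (int-+ (κ ℤ.* + M ℤ.+ + (M ℕ.+ (F ℕ.+ 1))) (+ E))))))))
  where
  M = 20 ℕ.* F

  below : κ ℤ.* + M ℤ.≤ (K ℤ.+ + E) ℤ.+ + (F ℕ.+ 2) → κ ℤ.* + M ℤ.≤ K ℤ.+ + (2 ℕ.* F)
  below h = ℤ.≤-trans h (ℤ.≤-trans (ℤ.≤-reflexive (ℤ.+-assoc K (+ E) (+ (F ℕ.+ 2))))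
    (ℤ.+-monoʳ-≤ K (ℤ.+≤+ (begin
      E ℕ.+ (F ℕ.+ 2)   ≡⟨ solve 2 (λ E F → E :+ (F :+ con 2) := F :+ (E :+ con 2)) refl E F ⟩
      F ℕ.+ (E ℕ.+ 2)   ≤⟨ ℕ.+-monoʳ-≤ F E+2≤F ⟩
      F ℕ.+ F           ≡⟨ cong (F ℕ.+_) (ℕ.+-identityʳ F) ⟨
      2 ℕ.* F           ∎))))
    where
    open ℕ.≤-Reasoning
    open ℕ-Solver

  above : K ℤ.≤ (κ ℤ.* + M ℤ.+ + (M ℕ.+ (F ℕ.+ 1))) ℤ.+ + E → K ℤ.+ + (2 ℕ.* F) ℤ.≤ κ ℤ.* + M ℤ.+ + (24 ℕ.* F)
  above h = ℤ.≤-trans (ℤ.+-monoˡ-≤ (+ (2 ℕ.* F)) h) (ℤ.≤-trans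
    (ℤ.≤-reflexive (trans (cong (ℤ._+ + (2 ℕ.* F)) (ℤ.+-assoc (κ ℤ.* + M) _ (+ E))) (ℤ.+-assoc (κ ℤ.* + M) _ (+ (2 ℕ.* F)))))
    (ℤ.+-monoʳ-≤ (κ ℤ.* + M) (ℤ.+≤+ (begin
      (M ℕ.+ (F ℕ.+ 1)) ℕ.+ E ℕ.+ 2 ℕ.* F
        -- A spare unit turns `E + 1` into the `E + 2` of the hypothesis.
        ≤⟨ ℕ.m≤m+n _ 1 ⟩
      (M ℕ.+ (F ℕ.+ 1)) ℕ.+ E ℕ.+ 2 ℕ.* F ℕ.+ 1
        ≡⟨ solve 2 (λ E F → (con 20 :* F :+ (F :+ con 1)) :+ E :+ con 2 :* F :+ con 1 := con 23 :* F :+ (E :+ con 2)) refl E F ⟩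
      23 ℕ.* F ℕ.+ (E ℕ.+ 2)
        ≤⟨ ℕ.+-monoʳ-≤ (23 ℕ.* F) E+2≤F ⟩
      23 ℕ.* F ℕ.+ F
        ≡⟨ ℕ.+-comm (23 ℕ.* F) F ⟩
      24 ℕ.* F ∎))))
    where
    open ℕ.≤-Reasoning
    open ℕ-Solver

eval-matches : ∀ {d} F .{{_ : ℕ.NonZero F}} m n W {η κ b I} (P : Polynomial d) (k : Vector ℤ (suc d)) →
  (∀ (j : Fin (suc d)) → n ℕ.^ toℕ j ℕ.≤ W) → suc d ℕ.* (2 ℕ.* W) ℕ.+ 2 ℕ.≤ F →
  (∀ i → I ℕ.≤ i → ∀ j →
     scale (20 ℕ.* F) ℚ.* seq (coeff P j) i ℚ.≤ int (k j ℤ.+ + 2) ×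
     int (k j) ℚ.≤ scale (20 ℕ.* F) ℚ.* seq (coeff P j) i ℚ.+ scale 2) →
  ∣ η ∣ ≤ fromℚ (+ 1 ℚ./ 20) → IsFloor (eval P (ℕ→ℝ n) + η) κ → κ ≡ + b [mod m ] →
  Matches F m (evalℤ k toℕ n) b
eval-matches {d} F m n W {η} {κ} {b} {I} P k n^j≤W E+2≤F near ∣η∣≤ floor κ≡b =
  let J , window = floor-window F {eval P (ℕ→ℝ n)} {η} {κ} ∣η∣≤ floor
      -- One index past both thresholds suffices, because the conclusion concerns integers only.
      i = I ℕ.⊔ J
      near-i = near i (ℕ.m≤m⊔n I J)
      κ≤y , y≤κ = window i (ℕ.m≤n⊔m I J)
      c = λ j → seq (coeff P j) i
      M = 20 ℕ.* F
  in near-matches F m {evalℤ k toℕ n} {κ} {b} {suc d ℕ.* (2 ℕ.* W)} {scale M ℚ.* evalℚ c toℕ n} E+2≤F κ≡b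
       (subst (λ y → int (κ ℤ.* + M) ℚ.≤ scale M ℚ.* y ℚ.+ scale (F ℕ.+ 2)) (seq-eval P n i) κ≤y)
       (subst (λ y → scale M ℚ.* y ℚ.≤ int (κ ℤ.* + M ℤ.+ + (M ℕ.+ (F ℕ.+ 1)))) (seq-eval P n i) y≤κ)
       (eval-≤ M n W c k toℕ n^j≤W (λ j → proj₁ (near-i j)))
       (≤-eval M n W c k toℕ n^j≤W (λ j → proj₂ (near-i j)))

-- Assembly of the block.

residue : ∀ q .{{_ : ℕ.NonZero q}} k → Σ[ r ∈ Fin q ] + q ℤ.∣ k ℤ.- + toℕ r
residue q k = fromℕ< (ℤ.n%ℕd<d k q) , ℤ.divides (k ℤ./ℕ q) (begin
  k ℤ.- + toℕ (fromℕ< (ℤ.n%ℕd<d k q))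
    ≡⟨ cong₂ (λ x y → x ℤ.- + y) (ℤ.a≡a%ℕn+[a/ℕn]*n k q) (Fin.toℕ-fromℕ< (ℤ.n%ℕd<d k q)) ⟩
  (+ (k ℤ.%ℕ q) ℤ.+ k ℤ./ℕ q ℤ.* + q) ℤ.- + (k ℤ.%ℕ q)
    ≡⟨ solve 2 (λ a b → (a :+ b) :- a := b) refl (+ (k ℤ.%ℕ q)) (k ℤ./ℕ q ℤ.* + q) ⟩
  k ℤ./ℕ q ℤ.* + q ∎)
  where
  open ≡-Reasoning
  open ℤ-Solver

-- The index is chosen before the floor `k`, which is then refuted whatever it is; so no floor has
-- to be computed.
Unattained : ∀ {m N} → ℕ → Vector (Fin m) N → Set
Unattained {m} {N} d b = (P : Polynomial d) (η : ℕ → ℝ) →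
  (∀ n → ∣ η n ∣ ≤ fromℚ (+ 1 ℚ./ 20)) →
  Σ[ i ∈ Fin N ] let n = suc (toℕ i) in
    ∀ (k : ℤ) → IsFloor (eval P (ℕ→ℝ n) + η n) k →
    ¬ (k ≡ + toℕ (b i) [mod m ])

-- The last two hypotheses serve the two halves of the argument: the rounding error fits into the
-- margin `F`, and the number of coefficient vectors modulo `Q` is small enough for the greedy
-- choice.
fine-grid-block : ∀ m d N F .{{_ : ℕ.NonZero F}} → 3 ℕ.≤ m → 1 ℕ.≤ N →
  suc d ℕ.* (2 ℕ.* N ℕ.^ d) ℕ.+ 2 ℕ.≤ F →
  (m ℕ.* (20 ℕ.* F)) ℕ.^ suc d ℕ.* 2 ℕ.^ N ℕ.< 3 ℕ.^ N →
  Σ[ b ∈ Vector (Fin m) N ] Unattained d b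
fine-grid-block m@(suc (suc (suc m-3))) d N F 3≤m@(ℕ.s≤s (ℕ.s≤s (ℕ.s≤s _))) 1≤N error≤F few = block , mismatch
  where
  M = 20 ℕ.* F
  Q = m ℕ.* M

  instance
    M≢0 : ℕ.NonZero M
    M≢0 = ℕ.m*n≢0 20 F
    Q≢0 : ℕ.NonZero Q
    Q≢0 = ℕ.m*n≢0 m M

  value : Fin (Q ℕ.^ suc d) → ℕ → ℤ
  value a = evalℤ (λ j → + toℕ (finToFun {Q} {suc d} a j)) toℕ

  avoiding : Σ[ b ∈ Vector (Fin m) N ] (∀ {a} → a ∈ allFin (Q ℕ.^ suc d) →
    ∃[ i ] ¬ Matches F m (value a (suc (toℕ i))) (toℕ (b i)))
  -- The block uses only the residues 0, 1, 2, embedded by `_↑ˡ m-3`. Positions count from 0 but `n`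
  -- from 1, hence `suc i`.
  avoiding = avoiding-block (λ i a b → Matches F m (value a (suc i)) (toℕ b))
    (λ i a b → matches? F m (value a (suc i)) (toℕ b)) (_↑ˡ m-3)
    (λ i a → ¬-matches-012 F m 3≤m (value a (suc i))) N (allFin (Q ℕ.^ suc d))
    (subst (λ c → c ℕ.* 2 ℕ.^ N ℕ.< 3 ℕ.^ N) (sym (List.length-tabulate {n = Q ℕ.^ suc d} id)) few)

  block : Vector (Fin m) N
  block = proj₁ avoiding

  module _ (P : Polynomial d) where
    k : Vector ℤ (suc d)
    k j = proj₁ (nearest M (coeff P j))

    -- The candidate standing for `P`: changing a grid coefficient by a multiple of `Q = m * M`
    -- changes the grid value at `n` by a multiple of `Q`, that is, `m` in the original units.
    a : Fin (Q ℕ.^ suc d)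
    a = funToFin (λ j → proj₁ (residue Q (k j)))

    k≡a : ∀ j → + Q ℤ.∣ k j ℤ.- + toℕ (finToFun {Q} {suc d} a j)
    k≡a j = subst (λ r → + Q ℤ.∣ k j ℤ.- + toℕ r)
      (sym (Fin.finToFun-funToFin (λ j → proj₁ (residue Q (k j))) j)) (proj₂ (residue Q (k j)))

    n^j≤N^d : ∀ (i : Fin N) (j : Fin (suc d)) → suc (toℕ i) ℕ.^ toℕ j ℕ.≤ N ℕ.^ d
    n^j≤N^d i j = ℕ.≤-trans (ℕ.^-monoˡ-≤ (toℕ j) (Fin.toℕ<n i))
      (ℕ.^-monoʳ-≤ N {{ℕ.>-nonZero 1≤N}} (Fin.toℕ≤pred[n] j))

    ¬matches⇒¬≡ : ∀ {η} i → ∣ η ∣ ≤ fromℚ (+ 1 ℚ./ 20) →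
      ¬ Matches F m (value a (suc (toℕ i))) (toℕ (block i)) →
      ∀ (κ : ℤ) → IsFloor (eval P (ℕ→ℝ (suc (toℕ i))) + η) κ → ¬ (κ ≡ + toℕ (block i) [mod m ])
    ¬matches⇒¬≡ {η} i ∣η∣≤ ¬match κ floor κ≡b =
      let I , near = eventually-all (λ j → proj₂ (nearest M (coeff P j)))
      in ¬match (matches-cong F m {evalℤ k toℕ (suc (toℕ i))} {value a (suc (toℕ i))} {toℕ (block i)}
        (evalℤ-cong-∣ {k = k} {λ j → + toℕ (finToFun {Q} {suc d} a j)} toℕ (suc (toℕ i)) k≡a)
        (eval-matches F m (suc (toℕ i)) (N ℕ.^ d) {η} {κ} {toℕ (block i)} {I} P k
          (n^j≤N^d i) error≤F near ∣η∣≤ floor κ≡b))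

  mismatch : Unattained d block
  -- The index depends on the candidate of `P` alone, not on the perturbations.
  mismatch P η ∣η∣≤ = map₂ (λ {i} → ¬matches⇒¬≡ P {η (suc (toℕ i))} i (∣η∣≤ (suc (toℕ i))))
    (proj₂ avoiding (∈-allFin (a P)))

-- The margin `F` is a constant times `N ^ d`, so `Q` has the form `c * N ^ d` with `c` independent
-- of `N`, as the growth comparison requires.
unattained-block : ∀ m d N → 3 ℕ.≤ m → 1 ℕ.≤ N →
  (m ℕ.* (20 ℕ.* (4 ℕ.* suc d)) ℕ.* N ℕ.^ d) ℕ.^ suc d ℕ.* 2 ℕ.^ N ℕ.< 3 ℕ.^ N →
  Σ[ b ∈ Vector (Fin m) N ] Unattained d b
unattained-block m d N 3≤m 1≤N few = fine-grid-block m d N F {{F≢0}} 3≤m 1≤N error≤F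
  (subst (λ q → q ℕ.^ suc d ℕ.* 2 ℕ.^ N ℕ.< 3 ℕ.^ N) Q≡ few)
  where
  W = N ℕ.^ d
  -- Twice the rounding error `suc d * (2 * W)`; the second copy absorbs the added 2.
  F = 4 ℕ.* suc d ℕ.* W

  W≢0 : ℕ.NonZero W
  W≢0 = ℕ.m^n≢0 N d {{ℕ.>-nonZero 1≤N}}

  F≢0 : ℕ.NonZero F
  F≢0 = ℕ.m*n≢0 (4 ℕ.* suc d) W {{_}} {{W≢0}}

  Q≡ : m ℕ.* (20 ℕ.* (4 ℕ.* suc d)) ℕ.* W ≡ m ℕ.* (20 ℕ.* F)
  Q≡ = trans (ℕ.*-assoc m (20 ℕ.* (4 ℕ.* suc d)) W) (cong (m ℕ.*_) (ℕ.*-assoc 20 (4 ℕ.* suc d) W))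

  error≤F : suc d ℕ.* (2 ℕ.* W) ℕ.+ 2 ℕ.≤ F
  error≤F = begin
    suc d ℕ.* (2 ℕ.* W) ℕ.+ 2
      ≤⟨ ℕ.+-monoʳ-≤ (suc d ℕ.* (2 ℕ.* W)) (ℕ.*-mono-≤ (ℕ.s≤s (ℕ.z≤n {d})) (ℕ.*-monoʳ-≤ 2 (ℕ.>-nonZero⁻¹ W {{W≢0}}))) ⟩
    suc d ℕ.* (2 ℕ.* W) ℕ.+ suc d ℕ.* (2 ℕ.* W)
      ≡⟨ solve 2 (λ D W → D :* (con 2 :* W) :+ D :* (con 2 :* W) := con 4 :* D :* W) refl (suc d) W ⟩
    F ∎
    where
    open ℕ.≤-Reasoning
    open ℕ-Solver

theorem6 : ∀ (m d : ℕ) → 3 ℕ.≤ m → 1 ℕ.≤ d →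
    ∃[ N ] 1 ℕ.≤ N × Σ[ b ∈ Vector (Fin m) N ]
    ((P : Polynomial d) (η : ℕ → ℝ) →
    (∀ n → ∣ η n ∣ ≤ fromℚ (+ 1 ℚ./ 20)) →
    Σ[ i ∈ Fin N ] let n = suc (toℕ i) in
    ∀ (k : ℤ) → IsFloor (eval P (ℕ→ℝ n) + η n) k →
    ¬ (k ≡ + toℕ (b i) [mod m ]))
theorem6 m d 3≤m _ = map₂ (λ {N} (1≤N , few) → 1≤N , unattained-block m d N 3≤m 1≤N few)
  (polynomial<exponential (m ℕ.* (20 ℕ.* (4 ℕ.* suc d))) d (suc d))
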